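{- For every sufficiently large power of two $n$, there are a partial function $f:\{0,1\}^{2n^2}\to\{0,1,*\}$, an input $z\in f^{ -1}(*)$, and total predicates $\varphi_0,\varphi_1:\{0,1\}^{2n^2}\times\{0,1\}^{\ell'}\to\{0,1\}$ with a common descriptor length $\ell'=\Theta(n\log n)$, such that: 1. $n\le \mathrm{C}(f)\le O(n\log n)$ and \[ \mathrm{C}_{\overline 1}(f,z)\ge \frac{n(n-1)}{2},\qquad \mathrm{C}_{\overline 0}(f,z)\ge \bigl(\tfrac12+o(1)\bigr)n^2; \] 2. for each $b\in\{0,1\}$ and each $x\in\{0,1\}^{2n^2}$: $f(x)=b$ if and only if there exists a descriptor $y\in\{0,1\}^{\ell'}$ with $\varphi_b(x,y)=1$; 3. each accepted descriptor persists after fixing a descriptor-dependent set of at most $O(n\log n)$ input coordinates: for each $b\in\{0,1\}$, each descriptor $y$ determines a set $I_b(y)\subseteq[2n^2]$ with $|I_b(y)|=O(n\log n)$ such that whenever $\varphi_b(x,y)=1$, we have $\varphi_b(x',y)=1$ for every $x'\in\{0,1\}^{2n^2}$ agreeing with $x$ on $I_b(y)$; 4. $\widetilde{\deg}(\varphi_0)=\widetilde{O}(\sqrt n)$ and $\widetilde{\deg}(\varphi_1)=\widetilde{O}(\sqrt n)$. Here the asymptotic notation is as $n\to\infty$ over powers of two (with constants not depending on $n$).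
   Context: A partial Boolean function is a map $f:\{0,1\}^N\to\{0,1,*\}$. A partial assignment is a string $\rho\in\{0,1,*\}^N$; its size $|\rho|$ is the number of $i$ with $\rho_i\ne *$; $x\in\{0,1\}^N$ is consistent with $\rho$ (a completion of $\rho$) if $\rho_i=x_i$ whenever $\rho_i\neq *$. For $\Sigma\subseteq\{0,1,*\}$ and $x$ with $f(x)\in\Sigma$, a $\Sigma$-certificate for $x$ is a partial assignment $\rho$ consistent with $x$ such that every completion $x'$ of $\rho$ has $f(x')\in\Sigma$; $\mathrm{C}_\Sigma(f,x)$ is the minimum size of a $\Sigma$-certificate for $x$, and $\mathrm{C}_\Sigma(f)=\max_{x\in f^{ -1}(\Sigma)}\mathrm{C}_\Sigma(f,x)$ (with $\max\varnothing=0$). For $b\in\{0,1\}$, $\mathrm{C}_b=\mathrm{C}_{\{b\}}$, and $\mathrm{C}(f)=\max\{\mathrm{C}_0(f),\mathrm{C}_1(f)\}$. For $x\in f^{ -1}(*)$ put $\mathrm{C}_{\overline 0}(f,x)=\mathrm{C}_{\{1,*\}}(f,x)$ and $\mathrm{C}_{\overline 1}(f,x)=\mathrm{C}_{\{0,*\}}(f,x)$. For a total Boolean function $g$ on $\{0,1\}^N$, $\widetilde{\deg}(g)$ is the least degree of a real polynomial $p$ with $|p(x)-g(x)|\le 1/3$ for all $x\in\{0,1\}^N$. Logarithms are base $2$; $\widetilde O$ suppresses factors polylogarithmic in $n$. -}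

module Defs where

import Algebra.Properties.Ring as RingProperties
open import Data.Bool.Base using (Bool; true; false; if_then_else_)
import Data.Bool.Properties as Bool
open import Data.Integer.Base using (+_)
open import Data.List.Base as List using (List; []; _∷_; filter; cartesianProductWith)
open import Data.List.Extrema.Nat using (min; max)
import Data.List.Membership.DecPropositional as DecMembership
open import Data.Maybe.Base using (Maybe; just; nothing; is-just)
open import Data.Maybe.Properties using (≡-dec)
import Data.Maybe.Relation.Unary.All as MaybeAll
open import Data.Nat.Base as ℕ using (ℕ; zero; suc)
import Data.Nat.Properties as ℕ
open import Data.Product.Base using (_×_; _,_; proj₂; ∃-syntax)
open import Data.Rational.Base as ℚ using (ℚ; 0ℚ; 1ℚ; ½)
import Data.Rational.Properties as ℚ
open import Data.Rational.Solver using (module +-*-Solver)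
open import Data.Sum.Base using (inj₁; inj₂)
open import Data.Vec.Base as Vec using (Vec; []; _∷_; count; take; drop)
open import Data.Vec.Relation.Binary.Pointwise.Inductive as Pointwise using (Pointwise)
open import Function.Base using (_∘_)
open import Relation.Binary.PropositionalEquality using (_≡_; refl; cong; cong₂; sym; trans; subst)
open import Relation.Nullary using (Dec)
open import Relation.Nullary.Decidable using (map′; _×-dec_; _→-dec_; T?)
open import Relation.Unary using (Decidable)

-- {0,1,*}, with * represented by nothing
Value : Set
Value = Maybe Bool

Input : ℕ → Set
Input N = Vec Bool N

PartialFunction : ℕ → Set
PartialFunction N = Input N → Value

PartialAssignment : ℕ → Set
PartialAssignment N = Vec Value N

size : ∀ {N} → PartialAssignment N → ℕ
size = count (T? ∘ is-just)

Consistent : ∀ {N} → PartialAssignment N → Input N → Set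
Consistent = Pointwise (λ r b → MaybeAll.All (_≡ b) r)

open DecMembership (≡-dec Bool._≟_) using (_∈_; _∈?_)

-- The first argument lists the elements of Σ ⊆ {0,1,*}.
Certificate : ∀ {N} → List Value → PartialFunction N → Input N → PartialAssignment N → Set
Certificate Σ f x ρ = Consistent ρ x × (∀ x′ → Consistent ρ x′ → f x′ ∈ Σ)

consistent? : ∀ {N} (ρ : PartialAssignment N) → Decidable (Consistent ρ)
consistent? = Pointwise.decidable (λ r b → MaybeAll.dec (Bool._≟ b) r)

∀-input? : ∀ {N} {P : Input N → Set} → Decidable P → Dec (∀ x → P x)
∀-input? {zero}  P? = map′ (λ { p [] → p }) (λ h → h []) (P? [])
∀-input? {suc N} P? =
  map′ (λ { (p , q) (false ∷ x) → p x ; (p , q) (true ∷ x) → q x })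
       (λ h → h ∘ (false ∷_) , h ∘ (true ∷_))
       (∀-input? (P? ∘ (false ∷_)) ×-dec ∀-input? (P? ∘ (true ∷_)))

certificate? : ∀ {N} Σ (f : PartialFunction N) x → Decidable (Certificate Σ f x)
certificate? Σ f x ρ =
  consistent? ρ x ×-dec ∀-input? (λ x′ → consistent? ρ x′ →-dec (f x′ ∈? Σ))

allVectors : {A : Set} → List A → (N : ℕ) → List (Vec A N)
allVectors as zero    = [] ∷ []
allVectors as (suc N) = cartesianProductWith _∷_ as (allVectors as N)

allInputs : (N : ℕ) → List (Input N)
allInputs = allVectors (false ∷ true ∷ [])

allAssignments : (N : ℕ) → List (PartialAssignment N)
allAssignments = allVectors (nothing ∷ just false ∷ just true ∷ [])

-- C_Σ(f,x). The default N of min does not affect the result when f x ∈ Σ: then x itself is a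
-- certificate, of size N, and no partial assignment is larger.
C-at : ∀ {N} → List Value → PartialFunction N → Input N → ℕ
C-at {N} Σ f x = min N (List.map size (filter (certificate? Σ f x) (allAssignments N)))

C-max : ∀ {N} → List Value → PartialFunction N → ℕ
C-max {N} Σ f = max 0 (List.map (C-at Σ f) (filter (λ x → f x ∈? Σ) (allInputs N)))

C : ∀ {N} → PartialFunction N → ℕ
C f = C-max (just false ∷ []) f ℕ.⊔ C-max (just true ∷ []) f

C-not0 : ∀ {N} → PartialFunction N → Input N → ℕ
C-not0 = C-at (just true ∷ nothing ∷ [])

C-not1 : ∀ {N} → PartialFunction N → Input N → ℕ
C-not1 = C-at (just false ∷ nothing ∷ [])

fromℕ : ℕ → ℚ
fromℕ n = + n ℚ./ 1

Cauchy : (ℕ → ℚ) → Set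
Cauchy s = ∀ ε → 0ℚ ℚ.< ε → ∃[ K ] ∀ m n → K ℕ.≤ m → K ℕ.≤ n → ℚ.∣ s m ℚ.- s n ∣ ℚ.≤ ε

-- Two sequences with the same limit represent the same real; ≤ᴿ compares limits.
record ℝ : Set where
  constructor mkℝ
  field
    seq    : ℕ → ℚ
    cauchy : Cauchy seq

open ℝ public

infix 4 _≤ᴿ_
_≤ᴿ_ : ℝ → ℝ → Set
x ≤ᴿ y = ∀ ε → 0ℚ ℚ.< ε → ∃[ K ] ∀ n → K ℕ.≤ n → seq x n ℚ.≤ seq y n ℚ.+ ε

private
  open +-*-Solver using (solve; _:+_; _:-_; :-_; _:=_)
  open RingProperties ℚ.+-*-ring using (x[y-z]≈xy-xz; [y-z]x≈yx-zx)

  half-pos : ∀ {ε} → 0ℚ ℚ.< ε → 0ℚ ℚ.< ε ℚ.* ½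
  half-pos {ε} 0<ε = subst (ℚ._< ε ℚ.* ½) (ℚ.*-zeroˡ ½) (ℚ.*-monoˡ-<-pos ½ 0<ε)

  half+half : ∀ ε → ε ℚ.* ½ ℚ.+ ε ℚ.* ½ ≡ ε
  half+half ε = trans (sym (ℚ.*-distribˡ-+ ε ½ ½)) (ℚ.*-identityʳ ε)

  cauchy-const : ∀ q → Cauchy (λ _ → q)
  cauchy-const q ε 0<ε = 0 , λ _ _ _ _ →
    subst (λ d → ℚ.∣ d ∣ ℚ.≤ ε) (sym (ℚ.+-inverseʳ q)) (ℚ.<⇒≤ 0<ε)

  cauchy-+ : ∀ {s t} → Cauchy s → Cauchy t → Cauchy (λ n → s n ℚ.+ t n)
  cauchy-+ {s} {t} cs ct ε 0<ε with cs (ε ℚ.* ½) (half-pos 0<ε) | ct (ε ℚ.* ½) (half-pos 0<ε)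
  ... | K , hs | L , ht = K ℕ.⊔ L , λ m n le le′ → begin
    ℚ.∣ (s m ℚ.+ t m) ℚ.- (s n ℚ.+ t n) ∣        ≡⟨ cong ℚ.∣_∣ (regroup (s m) (t m) (s n) (t n)) ⟩
    ℚ.∣ (s m ℚ.- s n) ℚ.+ (t m ℚ.- t n) ∣        ≤⟨ ℚ.∣p+q∣≤∣p∣+∣q∣ (s m ℚ.- s n) (t m ℚ.- t n) ⟩
    ℚ.∣ s m ℚ.- s n ∣ ℚ.+ ℚ.∣ t m ℚ.- t n ∣      ≤⟨ ℚ.+-mono-≤
      (hs m n (ℕ.m⊔n≤o⇒m≤o K L le) (ℕ.m⊔n≤o⇒m≤o K L le′))
      (ht m n (ℕ.m⊔n≤o⇒n≤o K L le) (ℕ.m⊔n≤o⇒n≤o K L le′)) ⟩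
    ε ℚ.* ½ ℚ.+ ε ℚ.* ½                          ≡⟨ half+half ε ⟩
    ε                                            ∎
    where
    open ℚ.≤-Reasoning
    regroup : ∀ a b c d → (a ℚ.+ b) ℚ.- (c ℚ.+ d) ≡ (a ℚ.- c) ℚ.+ (b ℚ.- d)
    regroup = solve 4 (λ a b c d → (a :+ b) :- (c :+ d) := (a :- c) :+ (b :- d)) refl

  cauchy-neg : ∀ {s} → Cauchy s → Cauchy (λ n → ℚ.- s n)
  cauchy-neg {s} cs ε 0<ε with cs ε 0<ε
  ... | K , hs = K , λ m n le le′ →
    subst (ℚ._≤ ε) (trans (sym (ℚ.∣-p∣≡∣p∣ (s m ℚ.- s n))) (cong ℚ.∣_∣ (flip (s m) (s n))))
          (hs m n le le′)
    where
    flip : ∀ a b → ℚ.- (a ℚ.- b) ≡ (ℚ.- a) ℚ.- (ℚ.- b)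
    flip = solve 2 (λ a b → :- (a :- b) := (:- a) :- (:- b)) refl

  eventually-bounded : ∀ {s} → Cauchy s →
    ∃[ B ] 0ℚ ℚ.< B × ∃[ K ] ∀ n → K ℕ.≤ n → ℚ.∣ s n ∣ ℚ.≤ B
  eventually-bounded {s} cs with cs 1ℚ (ℚ.positive⁻¹ 1ℚ)
  ... | K , hs = 1ℚ ℚ.+ ℚ.∣ s K ∣
               , ℚ.+-mono-<-≤ (ℚ.positive⁻¹ 1ℚ) (ℚ.0≤∣p∣ (s K))
               , K , λ n le → begin
    ℚ.∣ s n ∣                              ≡⟨ cong ℚ.∣_∣ (split (s n) (s K)) ⟩
    ℚ.∣ (s n ℚ.- s K) ℚ.+ s K ∣            ≤⟨ ℚ.∣p+q∣≤∣p∣+∣q∣ (s n ℚ.- s K) (s K) ⟩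
    ℚ.∣ s n ℚ.- s K ∣ ℚ.+ ℚ.∣ s K ∣        ≤⟨ ℚ.+-monoˡ-≤ ℚ.∣ s K ∣ (hs n K le ℕ.≤-refl) ⟩
    1ℚ ℚ.+ ℚ.∣ s K ∣                       ∎
    where
    open ℚ.≤-Reasoning
    split : ∀ a b → a ≡ (a ℚ.- b) ℚ.+ b
    split = solve 2 (λ a b → a := (a :- b) :+ b) refl

  scaled : ∀ {B ε} → 0ℚ ℚ.< B → 0ℚ ℚ.< ε → ∃[ δ ] 0ℚ ℚ.< δ × B ℚ.* δ ≡ ε
  scaled {B} {ε} 0<B 0<ε = ℚ.1/ B ℚ.* ε
    , subst (ℚ._< ℚ.1/ B ℚ.* ε) (ℚ.*-zeroʳ (ℚ.1/ B)) (ℚ.*-monoʳ-<-pos (ℚ.1/ B) 0<ε)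
    , trans (sym (ℚ.*-assoc B (ℚ.1/ B) ε))
            (trans (cong (ℚ._* ε) (ℚ.*-inverseʳ B)) (ℚ.*-identityˡ ε))
    where
    instance
      B-pos = ℚ.positive 0<B
      B≢0   = ℚ.pos⇒nonZero B
      1/B>0 = ℚ.1/pos⇒pos B

  *-bound : ∀ {B δ} a b → ℚ.∣ a ∣ ℚ.≤ B → ℚ.∣ b ∣ ℚ.≤ δ → 0ℚ ℚ.< B → ℚ.∣ a ℚ.* b ∣ ℚ.≤ B ℚ.* δ
  *-bound {B} {δ} a b ha hb 0<B = begin
    ℚ.∣ a ℚ.* b ∣            ≡⟨ ℚ.∣p*q∣≡∣p∣*∣q∣ a b ⟩
    ℚ.∣ a ∣ ℚ.* ℚ.∣ b ∣      ≤⟨ ℚ.*-monoʳ-≤-nonNeg ℚ.∣ b ∣ ha ⟩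
    B ℚ.* ℚ.∣ b ∣            ≤⟨ ℚ.*-monoˡ-≤-nonNeg B hb ⟩
    B ℚ.* δ                  ∎
    where
    open ℚ.≤-Reasoning
    instance
      b≥0 = ℚ.∣-∣-nonNeg b
      B≥0 = ℚ.nonNegative (ℚ.<⇒≤ 0<B)

  *-regroup : ∀ a b c d → a ℚ.* b ℚ.- c ℚ.* d ≡ a ℚ.* (b ℚ.- d) ℚ.+ d ℚ.* (a ℚ.- c)
  *-regroup a b c d = trans (telescope (a ℚ.* b) (a ℚ.* d) (c ℚ.* d))
    (cong₂ ℚ._+_ (sym (x[y-z]≈xy-xz a b d))
                 (trans (sym ([y-z]x≈yx-zx d a c)) (ℚ.*-comm (a ℚ.- c) d)))
    where
    telescope : ∀ u v w → u ℚ.- w ≡ (u ℚ.- v) ℚ.+ (v ℚ.- w)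
    telescope = solve 3 (λ u v w → u :- w := (u :- v) :+ (v :- w)) refl

  *-diff-bound : ∀ {A B α β} a b c d → 0ℚ ℚ.< A → 0ℚ ℚ.< B →
    ℚ.∣ a ∣ ℚ.≤ A → ℚ.∣ d ∣ ℚ.≤ B → ℚ.∣ b ℚ.- d ∣ ℚ.≤ α → ℚ.∣ a ℚ.- c ∣ ℚ.≤ β →
    ℚ.∣ a ℚ.* b ℚ.- c ℚ.* d ∣ ℚ.≤ A ℚ.* α ℚ.+ B ℚ.* β
  *-diff-bound {A} {B} {α} {β} a b c d 0<A 0<B a≤ d≤ b-d≤ a-c≤ = begin
    ℚ.∣ a ℚ.* b ℚ.- c ℚ.* d ∣
      ≡⟨ cong ℚ.∣_∣ (*-regroup a b c d) ⟩
    ℚ.∣ a ℚ.* (b ℚ.- d) ℚ.+ d ℚ.* (a ℚ.- c) ∣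
      ≤⟨ ℚ.∣p+q∣≤∣p∣+∣q∣ (a ℚ.* (b ℚ.- d)) (d ℚ.* (a ℚ.- c)) ⟩
    ℚ.∣ a ℚ.* (b ℚ.- d) ∣ ℚ.+ ℚ.∣ d ℚ.* (a ℚ.- c) ∣
      ≤⟨ ℚ.+-mono-≤ (*-bound a (b ℚ.- d) a≤ b-d≤ 0<A) (*-bound d (a ℚ.- c) d≤ a-c≤ 0<B) ⟩
    A ℚ.* α ℚ.+ B ℚ.* β ∎
    where open ℚ.≤-Reasoning

  cauchy-* : ∀ {s t} → Cauchy s → Cauchy t → Cauchy (λ n → s n ℚ.* t n)
  cauchy-* {s} {t} cs ct ε 0<ε =
    let A , 0<A , K₁ , s≤A = eventually-bounded {s} cs
        B , 0<B , K₂ , t≤B = eventually-bounded {t} ct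
        α , 0<α , Aα≡ = scaled {A} {ε ℚ.* ½} 0<A (half-pos {ε} 0<ε)
        β , 0<β , Bβ≡ = scaled {B} {ε ℚ.* ½} 0<B (half-pos {ε} 0<ε)
        K₃ , ht = ct α 0<α
        K₄ , hs = cs β 0<β
        K = (K₁ ℕ.⊔ K₂) ℕ.⊔ (K₃ ℕ.⊔ K₄)
        K₁₂≤ = ℕ.m≤m⊔n (K₁ ℕ.⊔ K₂) (K₃ ℕ.⊔ K₄)
        K₃₄≤ = ℕ.m≤n⊔m (K₁ ℕ.⊔ K₂) (K₃ ℕ.⊔ K₄)
        K₁≤ = ℕ.≤-trans (ℕ.m≤m⊔n K₁ K₂) K₁₂≤
        K₂≤ = ℕ.≤-trans (ℕ.m≤n⊔m K₁ K₂) K₁₂≤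
        K₃≤ = ℕ.≤-trans (ℕ.m≤m⊔n K₃ K₄) K₃₄≤
        K₄≤ = ℕ.≤-trans (ℕ.m≤n⊔m K₃ K₄) K₃₄≤
    in K , λ m n K≤m K≤n →
      subst (ℚ.∣ s m ℚ.* t m ℚ.- s n ℚ.* t n ∣ ℚ.≤_)
        (trans (cong₂ ℚ._+_ Aα≡ Bβ≡) (half+half ε))
        (*-diff-bound {A} {B} {α} {β} (s m) (t m) (s n) (t n) 0<A 0<B
          (s≤A m (ℕ.≤-trans K₁≤ K≤m)) (t≤B n (ℕ.≤-trans K₂≤ K≤n))
          (ht m n (ℕ.≤-trans K₃≤ K≤m) (ℕ.≤-trans K₃≤ K≤n))
          (hs m n (ℕ.≤-trans K₄≤ K≤m) (ℕ.≤-trans K₄≤ K≤n)))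

  ∣∣-diff : ∀ a b → ℚ.∣ a ∣ ℚ.- ℚ.∣ b ∣ ℚ.≤ ℚ.∣ a ℚ.- b ∣
  ∣∣-diff a b = begin
    ℚ.∣ a ∣ ℚ.- ℚ.∣ b ∣                         ≡⟨ cong (λ z → ℚ.∣ z ∣ ℚ.- ℚ.∣ b ∣) (split a b) ⟩
    ℚ.∣ (a ℚ.- b) ℚ.+ b ∣ ℚ.- ℚ.∣ b ∣           ≤⟨ ℚ.+-monoˡ-≤ (ℚ.- ℚ.∣ b ∣) (ℚ.∣p+q∣≤∣p∣+∣q∣ (a ℚ.- b) b) ⟩
    ℚ.∣ a ℚ.- b ∣ ℚ.+ ℚ.∣ b ∣ ℚ.- ℚ.∣ b ∣       ≡⟨ cancel ℚ.∣ a ℚ.- b ∣ ℚ.∣ b ∣ ⟩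
    ℚ.∣ a ℚ.- b ∣                               ∎
    where
    open ℚ.≤-Reasoning
    split : ∀ a b → a ≡ (a ℚ.- b) ℚ.+ b
    split = solve 2 (λ a b → a := (a :- b) :+ b) refl
    cancel : ∀ a b → (a ℚ.+ b) ℚ.- b ≡ a
    cancel = solve 2 (λ a b → (a :+ b) :- b := a) refl

  ∣∣-lipschitz : ∀ a b → ℚ.∣ ℚ.∣ a ∣ ℚ.- ℚ.∣ b ∣ ∣ ℚ.≤ ℚ.∣ a ℚ.- b ∣
  ∣∣-lipschitz a b with ℚ.∣p∣≡p∨∣p∣≡-p (ℚ.∣ a ∣ ℚ.- ℚ.∣ b ∣)
  ... | inj₁ eq = subst (ℚ._≤ ℚ.∣ a ℚ.- b ∣) (sym eq) (∣∣-diff a b)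
  ... | inj₂ eq = begin
    ℚ.∣ ℚ.∣ a ∣ ℚ.- ℚ.∣ b ∣ ∣    ≡⟨ eq ⟩
    ℚ.- (ℚ.∣ a ∣ ℚ.- ℚ.∣ b ∣)    ≡⟨ flip ℚ.∣ a ∣ ℚ.∣ b ∣ ⟩
    ℚ.∣ b ∣ ℚ.- ℚ.∣ a ∣          ≤⟨ ∣∣-diff b a ⟩
    ℚ.∣ b ℚ.- a ∣                ≡⟨ ℚ.∣-p∣≡∣p∣ (b ℚ.- a) ⟨
    ℚ.∣ ℚ.- (b ℚ.- a) ∣          ≡⟨ cong ℚ.∣_∣ (flip b a) ⟩
    ℚ.∣ a ℚ.- b ∣                ∎
    where
    open ℚ.≤-Reasoning
    flip : ∀ a b → ℚ.- (a ℚ.- b) ≡ b ℚ.- a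
    flip = solve 2 (λ a b → :- (a :- b) := b :- a) refl

  cauchy-∣∣ : ∀ {s} → Cauchy s → Cauchy (λ n → ℚ.∣ s n ∣)
  cauchy-∣∣ {s} cs ε 0<ε with cs ε 0<ε
  ... | K , hs = K , λ m n le le′ → ℚ.≤-trans (∣∣-lipschitz (s m) (s n)) (hs m n le le′)

infixl 6 _+ᴿ_ _-ᴿ_
infixl 7 _*ᴿ_
infixr 8 _^ᴿ_

fromℚ : ℚ → ℝ
fromℚ q = mkℝ (λ _ → q) (cauchy-const q)

_+ᴿ_ : ℝ → ℝ → ℝ
x +ᴿ y = mkℝ (λ n → seq x n ℚ.+ seq y n) (cauchy-+ {seq x} {seq y} (cauchy x) (cauchy y))

-ᴿ_ : ℝ → ℝ
-ᴿ x = mkℝ (λ n → ℚ.- seq x n) (cauchy-neg {seq x} (cauchy x))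

_-ᴿ_ : ℝ → ℝ → ℝ
x -ᴿ y = x +ᴿ (-ᴿ y)

_*ᴿ_ : ℝ → ℝ → ℝ
x *ᴿ y = mkℝ (λ n → seq x n ℚ.* seq y n) (cauchy-* {seq x} {seq y} (cauchy x) (cauchy y))

∣_∣ᴿ : ℝ → ℝ
∣ x ∣ᴿ = mkℝ (λ n → ℚ.∣ seq x n ∣) (cauchy-∣∣ {seq x} (cauchy x))

_^ᴿ_ : ℝ → ℕ → ℝ
x ^ᴿ zero  = fromℚ 1ℚ
x ^ᴿ suc e = x *ᴿ x ^ᴿ e

-- A monomial is given by its exponents, a polynomial by a list of coefficient-monomial pairs.
Monomial : ℕ → Set
Monomial N = Vec ℕ N

Polynomial : ℕ → Set
Polynomial N = List (ℝ × Monomial N)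

-- Degree of the expression: zero or cancelling coefficients are counted. This makes no
-- difference to the least degree of a polynomial with a given property of its values.
degree : ∀ {N} → Polynomial N → ℕ
degree p = max 0 (List.map (Vec.sum ∘ proj₂) p)

evalMonomial : ∀ {N} → Monomial N → Vec ℝ N → ℝ
evalMonomial m v = Vec.foldr′ _*ᴿ_ (fromℚ 1ℚ) (Vec.zipWith _^ᴿ_ v m)

eval : ∀ {N} → Polynomial N → Vec ℝ N → ℝ
eval p v = List.foldr (λ { (c , m) r → c *ᴿ evalMonomial m v +ᴿ r }) (fromℚ 0ℚ) p

bit : Bool → ℝ
bit b = fromℚ (if b then 1ℚ else 0ℚ)

Approximates : ∀ {N} → Polynomial N → (Input N → Bool) → Set
Approximates p g = ∀ x → ∣ eval p (Vec.map bit x) -ᴿ bit (g x) ∣ᴿ ≤ᴿ fromℚ (+ 1 ℚ./ 3)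

-- The approximate degree of g, the least degree of a polynomial approximating g, is at most d.
ApproxDegree≤ : ∀ {N} → (Input N → Bool) → ℕ → Set
ApproxDegree≤ {N} g d = ∃[ p ] degree {N} p ℕ.≤ d × Approximates p g

-- {0,1}^N × {0,1}^ℓ identified with {0,1}^(N+ℓ)
onConcatenation : ∀ {N ℓ} → (Input N → Vec Bool ℓ → Bool) → Input (N ℕ.+ ℓ) → Bool
onConcatenation {N} φ w = φ (take N w) (drop N w)

Vanishing : (ℕ → ℚ) → Set
Vanishing ε = ∀ δ → 0ℚ ℚ.< δ → ∃[ K ] ∀ k → K ℕ.≤ k → ℚ.∣ ε k ∣ ℚ.≤ δ

{-# OPTIONS --safe #-}
-- The input consists of two n × n bit matrices W and Y, and z = 0. The cells of W are the leaves of a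
-- binary tree of depth 2k, and every node of the tree carries a label, a set of four rows of Y.
--
-- A 1-certificate is a cell of W containing 1 together with zeros in all rows of Y that occur in the
-- labels on the path from the root to that cell. To exclude these at z one has to fix all of W.
--
-- A 0-certificate flags some rows of Y, points to a 1 in each of them, and lists all nodes of the tree
-- whose path meets no flagged row; the leaves among them are required to be 0 in W. It conflicts with
-- every 1-certificate: a flagged row on the path violates the zeros, and otherwise the leaf is listed.
-- The list is checked node by node (each child of a listed node is either listed, at a given address, or
-- has a flagged row in its label), so the check is a conjunction of O(n) tests reading O(log n) bits.
--
-- If at most half of the rows of Y are fixed entirely at z, all others can be flagged. The list
-- then has to have at most n entries: a random labelling has this property for all sets of flagged rows
-- that comprise at least half of the rows, since for a fixed set the mean of 4 ^ (number of listed nodes) is at most 2 and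
-- 2 · 2^n ≤ 4^n.
--
-- A conjunction of m tests of degree d has approximate degree O(d √m), by a Chebyshev polynomial of
-- order O(√m) applied to an affine function of the number of failing tests.
module Submission where

open import Algebra.Bundles using (CommutativeMonoid; CommutativeRing)
import Algebra.Properties.CommutativeSemigroup as CommutativeSemigroupProperties
import Algebra.Properties.Semiring.Mult as SemiringMult
open import Data.Bool.Base using (Bool; true; false; if_then_else_; not; _∧_)
open import Data.Bool.ListAction using (all; and)
import Data.Bool.Properties as Bool
open import Data.Empty as Empty using (⊥-elim)
open import Data.Fin.Base as Fin using (Fin; zero; suc; combine; remQuot)
import Data.Fin.Properties as Fin
import Data.Integer.Base as ℤ
import Data.Integer.Properties as ℤ
open import Data.List.Base as List
  using (List; []; _∷_; _++_; _ʳ++_; length; filter; allFin; upTo; cartesianProduct; cartesianProductWith)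
open import Data.List.Extrema.Nat using (v≤min⁺; min≤xs; max≤v⁺; xs≤max)
import Data.List.Membership.Propositional as List
open import Data.List.Membership.Propositional.Properties
import Data.List.Properties as List
open import Data.List.Relation.Unary.All as All using (All; []; _∷_)
import Data.List.Relation.Unary.All.Properties as All
open import Data.List.Relation.Unary.AllPairs using ([]; _∷_)
open import Data.List.Relation.Unary.Any as Any using (Any; here; there)
open import Data.List.Relation.Unary.Unique.Propositional using (Unique)
import Data.List.Relation.Unary.Unique.Propositional.Properties as Unique
open import Data.Maybe.Base using (Maybe; just; nothing; fromMaybe)
import Data.Maybe.Relation.Unary.All as Maybe
open import Data.Nat.Base as ℕ using (ℕ; zero; suc)
import Data.Nat.Properties as ℕ
open import Data.Nat.Solver using () renaming (module +-*-Solver to ℕ-Solver)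
open import Data.Product.Base using (_×_; _,_; proj₁; proj₂; ∃-syntax; Σ-syntax)
open import Data.Rational.Base as ℚ using (ℚ; 0ℚ; 1ℚ; ½)
import Data.Rational.Properties as ℚ
open import Data.Rational.Solver using (module +-*-Solver)
import Data.Rational.Unnormalised.Base as ℚᵘ
import Data.Rational.Unnormalised.Properties as ℚᵘ
open import Data.Sum.Base using (_⊎_; inj₁; inj₂; [_,_]′)
open import Data.Unit.Base using (⊤; tt)
open import Data.Vec.Base as Vec using (Vec; []; _∷_; lookup; toList; _[_]≔_)
import Data.Vec.Properties as Vec
open import Data.Vec.Relation.Binary.Pointwise.Inductive using ([]; _∷_)
open import Function.Base using (_∘_)
open import Function.Bundles using (_⇔_; mk⇔)
open import Function.Definitions using (Injective)
open import Relation.Binary.PropositionalEquality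
open import Relation.Nullary using (Dec; yes; no; ¬_; does; contradiction)
open import Relation.Nullary.Decidable using (map′; ¬?; dec-true; dec-false)
open import Relation.Unary using (Decidable)
open import Defs

open CommutativeSemigroupProperties ℕ.+-commutativeSemigroup using () renaming (interchange to ℕ-interchange)
open CommutativeSemigroupProperties (CommutativeMonoid.commutativeSemigroup ℚ.*-1-commutativeMonoid)
  using () renaming (interchange to ℚ-interchange)
open SemiringMult (CommutativeRing.semiring ℚ.+-*-commutativeRing) using (×1-homo-*) renaming (_×_ to _⋆_)
open +-*-Solver using (solve; _:+_; _:*_; _:-_; :-_; _:=_; con)

-- Polynomials on the cube

infixl 7 _*ᵐ_ _·_ _*ᴾ_

_*ᵐ_ : ∀ {N} → Monomial N → Monomial N → Monomial N
_*ᵐ_ = Vec.zipWith ℕ._+_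

_·_ : ∀ {N} → ℝ × Monomial N → Polynomial N → Polynomial N
(c , m) · q = List.map (λ (c′ , m′) → c *ᴿ c′ , m *ᵐ m′) q

_*ᴾ_ : ∀ {N} → Polynomial N → Polynomial N → Polynomial N
[]      *ᴾ q = []
(t ∷ p) *ᴾ q = t · q ++ p *ᴾ q

-- Real arithmetic acts termwise on the representing sequences, so the ring identities below are
-- proved as equations in ℚ at each index and no equality on ℝ is involved.
at : ℕ → ℝ → ℚ
at i x = seq x i

module _ {N} (v : Vec ℝ N) (i : ℕ) where

  eval-++ : ∀ p q → at i (eval p v +ᴿ eval q v) ≡ at i (eval (p ++ q) v)
  eval-++ []            q = ℚ.+-identityˡ _
  eval-++ ((c , m) ∷ p) q = trans (ℚ.+-assoc (at i (c *ᴿ evalMonomial m v)) (at i (eval p v)) (at i (eval q v))) (cong (at i (c *ᴿ evalMonomial m v) ℚ.+_) (eval-++ p q))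

^-+ : ∀ x a b i → at i (x ^ᴿ (a ℕ.+ b)) ≡ at i (x ^ᴿ a) ℚ.* at i (x ^ᴿ b)
^-+ x zero    b i = sym (ℚ.*-identityˡ _)
^-+ x (suc a) b i = trans (cong (at i x ℚ.*_) (^-+ x a b i)) (sym (ℚ.*-assoc (at i x) (at i (x ^ᴿ a)) (at i (x ^ᴿ b))))

evalMonomial-* : ∀ {N} (m m′ : Monomial N) v i →
  at i (evalMonomial (m *ᵐ m′) v) ≡ at i (evalMonomial m v) ℚ.* at i (evalMonomial m′ v)
evalMonomial-* []      []       []      i = refl
evalMonomial-* (a ∷ m) (b ∷ m′) (x ∷ v) i =
  trans (cong₂ ℚ._*_ (^-+ x a b i) (evalMonomial-* m m′ v i))
    (ℚ-interchange (at i (x ^ᴿ a)) (at i (x ^ᴿ b)) (at i (evalMonomial m v)) (at i (evalMonomial m′ v)))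

eval-· : ∀ {N} c (m : Monomial N) q v i →
  at i (eval ((c , m) · q) v) ≡ (at i c ℚ.* at i (evalMonomial m v)) ℚ.* at i (eval q v)
eval-· c m []              v i = sym (ℚ.*-zeroʳ (at i c ℚ.* at i (evalMonomial m v)))
eval-· c m ((c′ , m′) ∷ q) v i = trans
  (cong₂ ℚ._+_ (trans (cong (at i c ℚ.* at i c′ ℚ.*_) (evalMonomial-* m m′ v i)) (ℚ-interchange (at i c) (at i c′) (at i (evalMonomial m v)) (at i (evalMonomial m′ v))))
               (eval-· c m q v i))
  (sym (ℚ.*-distribˡ-+ (at i c ℚ.* at i (evalMonomial m v)) _ _))

eval-* : ∀ {N} (p q : Polynomial N) v i → at i (eval (p *ᴾ q) v) ≡ at i (eval p v) ℚ.* at i (eval q v)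
eval-* []            q v i = sym (ℚ.*-zeroˡ (at i (eval q v)))
eval-* ((c , m) ∷ p) q v i = trans (sym (eval-++ v i ((c , m) · q) (p *ᴾ q)))
  (trans (cong₂ ℚ._+_ (eval-· c m q v i) (eval-* p q v i))
         (sym (ℚ.*-distribʳ-+ (at i (eval q v)) (at i c ℚ.* at i (evalMonomial m v)) _)))

AllDegrees≤ : ∀ {N} → ℕ → Polynomial N → Set
AllDegrees≤ d = All (λ (_ , m) → Vec.sum m ℕ.≤ d)

sum-* : ∀ {N} (m m′ : Monomial N) → Vec.sum (m *ᵐ m′) ≡ Vec.sum m ℕ.+ Vec.sum m′
sum-* []      []       = refl
sum-* (a ∷ m) (b ∷ m′) = trans (cong (a ℕ.+ b ℕ.+_) (sum-* m m′)) (ℕ-interchange a b (Vec.sum m) (Vec.sum m′))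

·-degree : ∀ {N d e} t {q : Polynomial N} → Vec.sum (proj₂ t) ℕ.≤ d → AllDegrees≤ e q → AllDegrees≤ (d ℕ.+ e) (t · q)
·-degree t m≤ [] = []
·-degree {d = d} {e} t {(_ , m′) ∷ q} m≤ (m′≤ ∷ q≤) =
  subst (ℕ._≤ d ℕ.+ e) (sym (sum-* (proj₂ t) m′)) (ℕ.+-mono-≤ m≤ m′≤) ∷ ·-degree t m≤ q≤

*ᴾ-degree : ∀ {N d e} {p q : Polynomial N} → AllDegrees≤ d p → AllDegrees≤ e q → AllDegrees≤ (d ℕ.+ e) (p *ᴾ q)
*ᴾ-degree []         q≤ = []
*ᴾ-degree {p = t ∷ _} (m≤ ∷ p≤) q≤ = All.++⁺ (·-degree t m≤ q≤) (*ᴾ-degree p≤ q≤)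

-- All polynomials built here have rational values on the cube, attained exactly at every index of
-- the sequence. Sums, products and compositions can therefore be handled as rational functions `v`;
-- only `approximates` returns to real inequalities.
record HasDegree≤ {N} (v : Input N → ℚ) (d : ℕ) : Set where
  constructor represented
  field
    poly        : Polynomial N
    poly-degree : AllDegrees≤ d poly
    poly-value  : ∀ x i → at i (eval poly (Vec.map bit x)) ≡ v x
open HasDegree≤

one : ∀ {N} → Monomial N
one = Vec.replicate _ 0

evalMonomial-one : ∀ {N} (v : Vec ℝ N) i → at i (evalMonomial one v) ≡ 1ℚ
evalMonomial-one []      i = refl
evalMonomial-one (x ∷ v) i = trans (ℚ.*-identityˡ _) (evalMonomial-one v i)

sum-one : ∀ N → Vec.sum (one {N}) ≡ 0
sum-one zero    = refl
sum-one (suc N) = sum-one N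

single : ∀ {N} → Fin N → Monomial N
single zero    = 1 ∷ one
single (suc j) = 0 ∷ single j

evalMonomial-single : ∀ {N} (v : Vec ℝ N) j i → at i (evalMonomial (single j) v) ≡ at i (lookup v j)
evalMonomial-single (x ∷ v) zero    i =
  trans (cong₂ ℚ._*_ (ℚ.*-identityʳ (at i x)) (evalMonomial-one v i)) (ℚ.*-identityʳ (at i x))
evalMonomial-single (x ∷ v) (suc j) i = trans (ℚ.*-identityˡ _) (evalMonomial-single v j i)

sum-single : ∀ {N} (j : Fin N) → Vec.sum (single j) ≡ 1
sum-single {suc N} zero    = cong suc (sum-one N)
sum-single         (suc j) = sum-single j

⟦_⟧ : Bool → ℚ
⟦ b ⟧ = if b then 1ℚ else 0ℚ

constant : ∀ {N d} q → HasDegree≤ {N} (λ _ → q) d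
constant q .poly = (fromℚ q , one) ∷ []
constant {N} {d} q .poly-degree = subst (ℕ._≤ d) (sym (sum-one N)) ℕ.z≤n ∷ []
constant q .poly-value x i =
  trans (ℚ.+-identityʳ _) (trans (cong (q ℚ.*_) (evalMonomial-one (Vec.map bit x) i)) (ℚ.*-identityʳ q))

variable-degree : ∀ {N d} (j : Fin N) → HasDegree≤ (λ x → ⟦ lookup x j ⟧) (suc d)
variable-degree j .poly = (fromℚ 1ℚ , single j) ∷ []
variable-degree {d = d} j .poly-degree = subst (ℕ._≤ suc d) (sym (sum-single j)) (ℕ.s≤s ℕ.z≤n) ∷ []
variable-degree j .poly-value x i = trans (ℚ.+-identityʳ _) (trans (ℚ.*-identityˡ _)
  (trans (evalMonomial-single (Vec.map bit x) j i) (cong (at i) (Vec.lookup-map j bit x))))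

module _ {N} {v w : Input N → ℚ} where

  infixl 6 _+ᵈ_
  infixl 7 _*ᵈ_

  _+ᵈ_ : ∀ {d} → HasDegree≤ v d → HasDegree≤ w d → HasDegree≤ (λ x → v x ℚ.+ w x) d
  (p +ᵈ q) .poly = p .poly ++ q .poly
  (p +ᵈ q) .poly-degree = All.++⁺ (p .poly-degree) (q .poly-degree)
  (p +ᵈ q) .poly-value x i =
    trans (sym (eval-++ (Vec.map bit x) i (p .poly) (q .poly))) (cong₂ ℚ._+_ (p .poly-value x i) (q .poly-value x i))

  _*ᵈ_ : ∀ {d e} → HasDegree≤ v d → HasDegree≤ w e → HasDegree≤ (λ x → v x ℚ.* w x) (d ℕ.+ e)
  (p *ᵈ q) .poly = p .poly *ᴾ q .poly
  (p *ᵈ q) .poly-degree = *ᴾ-degree (p .poly-degree) (q .poly-degree)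
  (p *ᵈ q) .poly-value x i =
    trans (eval-* (p .poly) (q .poly) (Vec.map bit x) i) (cong₂ ℚ._*_ (p .poly-value x i) (q .poly-value x i))

  degree-cong : ∀ {d} → (∀ x → v x ≡ w x) → HasDegree≤ v d → HasDegree≤ w d
  degree-cong v≗w p = represented (p .poly) (p .poly-degree) (λ x i → trans (p .poly-value x i) (v≗w x))

degree-mono : ∀ {N} {v : Input N → ℚ} {d e} → d ℕ.≤ e → HasDegree≤ v d → HasDegree≤ v e
degree-mono d≤e p = represented (p .poly) (All.map (λ m≤d → ℕ.≤-trans m≤d d≤e) (p .poly-degree)) (p .poly-value)

⅓ : ℚ
⅓ = ℤ.+ 1 ℚ./ 3

≤-+ε : ∀ {q r ε} → q ℚ.≤ r → 0ℚ ℚ.< ε → q ℚ.≤ r ℚ.+ ε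
≤-+ε {q} {r} {ε} q≤r 0<ε = begin
  q           ≤⟨ q≤r ⟩
  r           ≡⟨ ℚ.+-identityʳ r ⟨
  r ℚ.+ 0ℚ    ≤⟨ ℚ.+-monoʳ-≤ r (ℚ.<⇒≤ 0<ε) ⟩
  r ℚ.+ ε     ∎
  where open ℚ.≤-Reasoning

approximates : ∀ {N} {v : Input N → ℚ} {g d} → HasDegree≤ v d →
  (∀ x → ℚ.∣ v x ℚ.- ⟦ g x ⟧ ∣ ℚ.≤ ⅓) → ApproxDegree≤ g d
approximates {N} {v} {g} {d} p close =
  p .poly , max≤v⁺ {v = d} {⊥ = 0} {xs = List.map (Vec.sum ∘ proj₂) (p .poly)} ℕ.z≤n (All.map⁺ (p .poly-degree)) , approx
  where
  approx : Approximates (p .poly) g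
  approx x ε 0<ε = 0 , λ i _ → ≤-+ε (subst (λ q → ℚ.∣ q ℚ.- ⟦ g x ⟧ ∣ ℚ.≤ ⅓) (sym (p .poly-value x i)) (close x)) 0<ε

-- Chebyshev polynomials and conjunctions

module _ where
  open import Data.Rational.Base

  -- The polynomial inequalities below are certified by their slack `d`: it is written in a form
  -- that is visibly nonnegative, and the ring solver checks the identity.
  +-≤ : ∀ {p q} d → 0ℚ ≤ d → q ≡ p + d → p ≤ q
  +-≤ {p} {q} d 0≤d eq = begin
    p         ≡⟨ ℚ.+-identityʳ p ⟨
    p + 0ℚ    ≤⟨ ℚ.+-monoʳ-≤ p 0≤d ⟩
    p + d     ≡⟨ eq ⟨
    q         ∎
    where open ℚ.≤-Reasoning

  0≤+ : ∀ {p q} → 0ℚ ≤ p → 0ℚ ≤ q → 0ℚ ≤ p + q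
  0≤+ 0≤p 0≤q = ℚ.+-mono-≤ 0≤p 0≤q

  0≤* : ∀ {p q} → 0ℚ ≤ p → 0ℚ ≤ q → 0ℚ ≤ p * q
  0≤* {p} {q} 0≤p 0≤q = ℚ.nonNegative⁻¹ (p * q) {{ℚ.nonNeg*nonNeg⇒nonNeg p {{nonNegative 0≤p}} q {{nonNegative 0≤q}}}}

  0≤- : ∀ {p q} → p ≤ q → 0ℚ ≤ q - p
  0≤- {p} {q} p≤q = subst (_≤ q - p) (ℚ.+-inverseʳ p) (ℚ.+-monoˡ-≤ (- p) p≤q)

  0≤square : ∀ q → 0ℚ ≤ q * q
  0≤square q with ℚ.≤-total 0ℚ q
  ... | inj₁ 0≤q = 0≤* 0≤q 0≤q
  ... | inj₂ q≤0 = subst (0ℚ ≤_) (solve 1 (λ q → (:- q) :* (:- q) := q :* q) refl q) (0≤* 0≤-q 0≤-q)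
    where
    0≤-q : 0ℚ ≤ - q
    0≤-q = ℚ.neg-antimono-≤ q≤0

  square≤1 : ∀ q → q * q ≤ 1ℚ → ∣ q ∣ ≤ 1ℚ
  square≤1 q q²≤1 with ∣ q ∣ ℚ.≤? 1ℚ
  ... | yes ∣q∣≤1 = ∣q∣≤1
  ... | no  ∣q∣≰1 = contradiction (ℚ.<-≤-trans 1<q² q²≤1) (ℚ.<-irrefl refl)
    where
    open ℚ.≤-Reasoning
    1<∣q∣ = ℚ.≰⇒> ∣q∣≰1
    ∣q∣² : ∣ q ∣ * ∣ q ∣ ≡ q * q
    ∣q∣² with ℚ.∣p∣≡p∨∣p∣≡-p q
    ... | inj₁ eq rewrite eq = refl
    ... | inj₂ eq rewrite eq = solve 1 (λ q → (:- q) :* (:- q) := q :* q) refl q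
    1<q² : 1ℚ < q * q
    1<q² = begin-strict
      1ℚ               <⟨ 1<∣q∣ ⟩
      ∣ q ∣            ≡⟨ ℚ.*-identityʳ ∣ q ∣ ⟨
      ∣ q ∣ * 1ℚ       ≤⟨ ℚ.*-monoˡ-≤-nonNeg ∣ q ∣ {{ℚ.∣-∣-nonNeg q}} (ℚ.<⇒≤ 1<∣q∣) ⟩
      ∣ q ∣ * ∣ q ∣    ≡⟨ ∣q∣² ⟩
      q * q            ∎

  -- chebU e is the Chebyshev polynomial of the second kind of degree e - 1.
  chebT chebU : ℕ → ℚ → ℚ
  chebT zero    u = 1ℚ
  chebT (suc e) u = u * chebT e u + (u * u - 1ℚ) * chebU e u
  chebU zero    u = 0ℚ
  chebU (suc e) u = chebT e u + u * chebU e u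

  -- Formally, T + U √(u² - 1) is a power of u + √(u² - 1), an element of norm 1. Each step of the
  -- recursion multiplies by that element once more and so preserves the norm T² - (u² - 1) U².
  pell : ∀ e u → chebT e u * chebT e u + (1ℚ - u * u) * (chebU e u * chebU e u) ≡ 1ℚ
  pell zero    u = solve 1 (λ u → con 1ℚ :* con 1ℚ :+ (con 1ℚ :- u :* u) :* (con 0ℚ :* con 0ℚ) := con 1ℚ) refl u
  pell (suc e) u = trans (step u (chebT e u) (chebU e u)) (pell e u)
    where
    step : ∀ u t w → (u * t + (u * u - 1ℚ) * w) * (u * t + (u * u - 1ℚ) * w) + (1ℚ - u * u) * ((t + u * w) * (t + u * w))
                     ≡ t * t + (1ℚ - u * u) * (w * w)
    step = solve 3 (λ u t w →
      (u :* t :+ (u :* u :- con 1ℚ) :* w) :* (u :* t :+ (u :* u :- con 1ℚ) :* w)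
        :+ (con 1ℚ :- u :* u) :* ((t :+ u :* w) :* (t :+ u :* w))
      := t :* t :+ (con 1ℚ :- u :* u) :* (w :* w)) refl

  -- For u² ≤ 1 the second summand in `pell` is nonnegative, so the first is at most 1.
  ∣chebT∣≤1 : ∀ e u → u * u ≤ 1ℚ → ∣ chebT e u ∣ ≤ 1ℚ
  ∣chebT∣≤1 e u u²≤1 = square≤1 (chebT e u) (+-≤ _ (0≤* (0≤- u²≤1) (0≤square (chebU e u))) (sym (pell e u)))

  ι : ℕ → ℚ
  ι n = n ⋆ 1ℚ

  0≤1 : 0ℚ ≤ 1ℚ
  0≤1 = ℚ.<⇒≤ (ℚ.positive⁻¹ 1ℚ)

  0≤ι : ∀ n → 0ℚ ≤ ι n
  0≤ι zero    = ℚ.≤-refl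
  0≤ι (suc n) = 0≤+ 0≤1 (0≤ι n)

  ι-mono : ∀ {m n} → m ℕ.≤ n → ι m ≤ ι n
  ι-mono {n = n} ℕ.z≤n   = 0≤ι n
  ι-mono (ℕ.s≤s m≤n) = ℚ.+-monoʳ-≤ 1ℚ (ι-mono m≤n)

  module _ (δ : ℚ) (0≤δ : 0ℚ ≤ δ) where

    -- The two bounds need each other in the induction. The growth just outside [-1, 1] is quadratic
    -- in `e`; this is what makes an order of about √m sufficient for m tests.
    chebT-growth : ∀ e → 1ℚ + ι e * ι e * δ ≤ chebT e (1ℚ + δ) × ι e ≤ chebU e (1ℚ + δ)
    chebT-growth zero    = ℚ.≤-reflexive (solve 1 (λ δ → con 1ℚ :+ con 0ℚ :* con 0ℚ :* δ := con 1ℚ) refl δ) , ℚ.≤-refl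
    chebT-growth (suc e) =
      let T≥ , U≥ = chebT-growth e
          i = ι e ; t = chebT e (1ℚ + δ) ; w = chebU e (1ℚ + δ)
          0≤i = 0≤ι e
          0≤1+δ = 0≤+ 0≤1 0≤δ
      -- The slack of the new bound is a nonnegative combination of the slacks `t - (1 + i² δ)` and
      -- `w - i` of the induction hypothesis, plus the remainder δ² (i² + i).
      in +-≤ ((1ℚ + δ) * (t - (1ℚ + i * i * δ)) + δ * (1ℚ + (1ℚ + δ)) * (w - i) + δ * δ * (i * i + i))
             (0≤+ (0≤+ (0≤* 0≤1+δ (0≤- T≥)) (0≤* (0≤* 0≤δ (0≤+ 0≤1 0≤1+δ)) (0≤- U≥)))
                  (0≤* (0≤* 0≤δ 0≤δ) (0≤+ (0≤* 0≤i 0≤i) 0≤i)))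
             (chebT-step δ i t w)
       , +-≤ ((t - (1ℚ + i * i * δ)) + i * i * δ + (w - i) + δ * w)
             (0≤+ (0≤+ (0≤+ (0≤- T≥) (0≤* (0≤* 0≤i 0≤i) 0≤δ)) (0≤- U≥)) (0≤* 0≤δ (ℚ.≤-trans 0≤i U≥)))
             (chebU-step δ i t w)
      where
      chebT-step : ∀ δ i t w → (1ℚ + δ) * t + ((1ℚ + δ) * (1ℚ + δ) - 1ℚ) * w
        ≡ 1ℚ + (1ℚ + i) * (1ℚ + i) * δ
          + ((1ℚ + δ) * (t - (1ℚ + i * i * δ)) + δ * (1ℚ + (1ℚ + δ)) * (w - i) + δ * δ * (i * i + i))
      chebT-step = solve 4 (λ δ i t w → let l = con 1ℚ in
        (l :+ δ) :* t :+ ((l :+ δ) :* (l :+ δ) :- l) :* w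
        := l :+ (l :+ i) :* (l :+ i) :* δ
          :+ ((l :+ δ) :* (t :- (l :+ i :* i :* δ)) :+ δ :* (l :+ (l :+ δ)) :* (w :- i) :+ δ :* δ :* (i :* i :+ i))) refl
      chebU-step : ∀ δ i t w → t + (1ℚ + δ) * w ≡ 1ℚ + i + ((t - (1ℚ + i * i * δ)) + i * i * δ + (w - i) + δ * w)
      chebU-step = solve 4 (λ δ i t w → let l = con 1ℚ in
        t :+ (l :+ δ) :* w := l :+ i :+ ((t :- (l :+ i :* i :* δ)) :+ i :* i :* δ :+ (w :- i) :+ δ :* w)) refl

  0≤⅓ : 0ℚ ≤ ⅓
  0≤⅓ = ℚ.<⇒≤ (ℚ.positive⁻¹ ⅓)

  -- Division by t = chebT e (1 + δ) makes chebT e small on [-1, 1] and 1 at 1 + δ.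
  module Normalised (t : ℚ) (3≤t : ι 3 ≤ t) where

    private instance
      t-pos : Positive t
      t-pos = positive (ℚ.<-≤-trans (ℚ.positive⁻¹ (ι 3)) 3≤t)
      t≢0 : NonZero t
      t≢0 = ℚ.pos⇒nonZero t

    c : ℚ
    c = 1/ t

    c*t≡1 : c * t ≡ 1ℚ
    c*t≡1 = ℚ.*-inverseˡ t

    0≤c : 0ℚ ≤ c
    0≤c = ℚ.<⇒≤ (ℚ.positive⁻¹ c {{ℚ.1/pos⇒pos t}})

    c≤⅓ : c ≤ ⅓
    c≤⅓ = +-≤ (⅓ * (c * (t - ι 3))) (0≤* 0≤⅓ (0≤* 0≤c (0≤- 3≤t))) (begin
      ⅓                                    ≡⟨ ℚ.*-identityʳ ⅓ ⟨
      ⅓ * 1ℚ                               ≡⟨ cong (⅓ *_) c*t≡1 ⟨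
      ⅓ * (c * t)                          ≡⟨ solve 2 (λ c t → con ⅓ :* (c :* t) := c :+ con ⅓ :* (c :* (t :- con (ι 3)))) refl c t ⟩
      c + ⅓ * (c * (t - ι 3))              ∎)
      where open ≡-Reasoning

    small : ∀ {q} → ∣ q ∣ ≤ 1ℚ → ∣ c * q - 0ℚ ∣ ≤ ⅓
    small {q} ∣q∣≤1 = begin
      ∣ c * q - 0ℚ ∣      ≡⟨ cong ∣_∣ (ℚ.+-identityʳ (c * q)) ⟩
      ∣ c * q ∣           ≡⟨ ℚ.∣p*q∣≡∣p∣*∣q∣ c q ⟩
      ∣ c ∣ * ∣ q ∣       ≡⟨ cong (_* ∣ q ∣) (ℚ.0≤p⇒∣p∣≡p 0≤c) ⟩
      c * ∣ q ∣           ≤⟨ ℚ.*-monoˡ-≤-nonNeg c {{nonNegative 0≤c}} ∣q∣≤1 ⟩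
      c * 1ℚ              ≡⟨ ℚ.*-identityʳ c ⟩
      c                   ≤⟨ c≤⅓ ⟩
      ⅓                   ∎
      where open ℚ.≤-Reasoning

    exact : ∣ c * t - 1ℚ ∣ ≤ ⅓
    exact = subst (λ q → ∣ q - 1ℚ ∣ ≤ ⅓) (sym c*t≡1) 0≤⅓

  module _ {N} (x : Input N) where

    fails : List (Input N → Bool) → ℚ
    fails []       = 0ℚ
    fails (g ∷ gs) = (1ℚ - ⟦ g x ⟧) + fails gs

    0≤fails : ∀ gs → 0ℚ ≤ fails gs
    0≤fails []       = ℚ.≤-refl
    0≤fails (g ∷ gs) with g x
    ... | true  = 0≤+ ℚ.≤-refl (0≤fails gs)
    ... | false = 0≤+ 0≤1 (0≤fails gs)

    fails≤length : ∀ gs → fails gs ≤ ι (length gs)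
    fails≤length []       = ℚ.≤-refl
    fails≤length (g ∷ gs) with g x
    ... | true  = ℚ.+-mono-≤ 0≤1 (fails≤length gs)
    ... | false = ℚ.+-monoʳ-≤ 1ℚ (fails≤length gs)

    no-fails : ∀ gs → all (λ g → g x) gs ≡ true → fails gs ≡ 0ℚ
    no-fails []       _    = refl
    no-fails (g ∷ gs) pass with g x
    ... | true = trans (ℚ.+-identityˡ (fails gs)) (no-fails gs pass)

    some-fails : ∀ gs → all (λ g → g x) gs ≡ false → 1ℚ ≤ fails gs
    some-fails (g ∷ gs) fail with g x
    ... | true  = subst (1ℚ ≤_) (sym (ℚ.+-identityˡ (fails gs))) (some-fails gs fail)
    ... | false = ℚ.+-monoʳ-≤ 1ℚ (0≤fails gs)

  fails-degree : ∀ {N d} {gs : List (Input N → Bool)} →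
    All (λ g → HasDegree≤ (λ x → ⟦ g x ⟧) d) gs → HasDegree≤ (λ x → fails x gs) d
  fails-degree []               = constant 0ℚ
  fails-degree {gs = g ∷ gs} (p ∷ ps) = (constant 1ℚ +ᵈ negate) +ᵈ fails-degree ps
    where
    negate : HasDegree≤ (λ x → - ⟦ g x ⟧) _
    negate = degree-cong (λ x → solve 1 (λ q → con (- 1ℚ) :* q := :- q) refl ⟦ g x ⟧) (constant {d = 0} (- 1ℚ) *ᵈ p)

  module _ {N d} {v : Input N → ℚ} (p : HasDegree≤ v d) where

    -- The doubled degree is slack from the mutual recursion: `chebU e` gets the same bound as
    -- `chebT e`, and the step multiplies it by v² - 1, of degree `d + d`.
    chebT-degree : ∀ e → HasDegree≤ (λ x → chebT e (v x)) (e ℕ.* (d ℕ.+ d))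
    chebU-degree : ∀ e → HasDegree≤ (λ x → chebU e (v x)) (e ℕ.* (d ℕ.+ d))
    chebT-degree zero    = constant 1ℚ
    chebT-degree (suc e) = degree-mono (ℕ.+-monoˡ-≤ _ (ℕ.m≤m+n d d)) (p *ᵈ chebT-degree e)
      +ᵈ ((p *ᵈ p) +ᵈ constant (- 1ℚ)) *ᵈ chebU-degree e
    chebU-degree zero    = constant 0ℚ
    chebU-degree (suc e) = degree-mono (ℕ.m≤n+m _ (d ℕ.+ d)) (chebT-degree e)
      +ᵈ degree-mono (ℕ.+-monoˡ-≤ _ (ℕ.m≤m+n d d)) (p *ᵈ chebU-degree e)

  module _ {N d} (gs : List (Input N → Bool)) (ps : All (λ g → HasDegree≤ (λ x → ⟦ g x ⟧) d) gs)
           (m e : ℕ) .{{_ : ℕ.NonZero m}} (gs≤m : length gs ℕ.≤ m) (2m≤e² : 2 ℕ.* m ℕ.≤ e ℕ.* e) where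

    private
      instance
        ιm-pos : Positive (ι m)
        ιm-pos = positive (ℚ.<-≤-trans (ℚ.positive⁻¹ (ι 1)) (ι-mono (ℕ.>-nonZero⁻¹ m)))
        ιm≢0 : NonZero (ι m)
        ιm≢0 = ℚ.pos⇒nonZero (ι m)

      δ : ℚ
      δ = 1/ ι m

      mδ≡1 : ι m * δ ≡ 1ℚ
      mδ≡1 = ℚ.*-inverseʳ (ι m)

      0≤δ : 0ℚ ≤ δ
      0≤δ = ℚ.<⇒≤ (ℚ.positive⁻¹ δ {{ℚ.1/pos⇒pos (ι m)}})

      t = chebT e (1ℚ + δ)

      -- By `chebT-growth`, t ≥ 1 + e² / m, and e² ≥ 2m.
      3≤t : ι 3 ≤ t
      3≤t = ℚ.≤-trans (+-≤ ((ι (e ℕ.* e) - ι (2 ℕ.* m)) * δ) (0≤* (0≤- (ι-mono 2m≤e²)) 0≤δ) eq) (proj₁ (chebT-growth δ 0≤δ e))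
        where
        expand : ∀ E M δ → 1ℚ + E * δ ≡ 1ℚ + ι 2 * (M * δ) + (E - ι 2 * M) * δ
        expand = solve 3 (λ E M δ → con 1ℚ :+ E :* δ := con 1ℚ :+ con (ι 2) :* (M :* δ) :+ (E :- con (ι 2) :* M) :* δ) refl
        eq : 1ℚ + ι e * ι e * δ ≡ ι 3 + (ι (e ℕ.* e) - ι (2 ℕ.* m)) * δ
        eq = trans (cong (λ q → 1ℚ + q * δ) (sym (×1-homo-* e e)))
            (trans (expand (ι (e ℕ.* e)) (ι m) δ)
                   (cong₂ (λ q r → q + (ι (e ℕ.* e) - r) * δ) (cong (λ q → 1ℚ + ι 2 * q) mδ≡1) (sym (×1-homo-* 2 m))))

      -- With s failing tests this is 1 + (1 - s) / m: it equals 1 + δ if all tests pass and lies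
      -- between δ and 1 for 1 ≤ s ≤ m.
      u : Input N → ℚ
      u x = 1ℚ + δ * (1ℚ + (- 1ℚ) * fails x gs)

      u-degree : HasDegree≤ u d
      u-degree = constant 1ℚ +ᵈ (constant {d = 0} δ *ᵈ (constant 1ℚ +ᵈ (constant {d = 0} (- 1ℚ) *ᵈ fails-degree ps)))

      open Normalised t 3≤t

      at-pass : ∀ δ → 1ℚ + δ * (1ℚ + (- 1ℚ) * 0ℚ) ≡ 1ℚ + δ
      at-pass = solve 1 (λ δ → con 1ℚ :+ δ :* (con 1ℚ :+ con (- 1ℚ) :* con 0ℚ) := con 1ℚ :+ δ) refl

      at-fail : ∀ δ M s → 1ℚ ≤ s → s ≤ M → 0ℚ ≤ δ → M * δ ≡ 1ℚ →
        let u = 1ℚ + δ * (1ℚ + (- 1ℚ) * s) in u * u ≤ 1ℚ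
      at-fail δ M s 1≤s s≤M 0≤δ Mδ≡1 = +-≤ ((1ℚ + v) * (1ℚ - v)) (0≤* (0≤+ 0≤1 0≤v) 0≤1-v) (square v)
        where
        v = 1ℚ + δ * (1ℚ + (- 1ℚ) * s)
        square : ∀ v → 1ℚ ≡ v * v + (1ℚ + v) * (1ℚ - v)
        square = solve 1 (λ v → con 1ℚ := v :* v :+ (con 1ℚ :+ v) :* (con 1ℚ :- v)) refl
        lower : ∀ δ M s → δ + (M - s) * δ ≡ M * δ + δ * (1ℚ + (- 1ℚ) * s)
        lower = solve 3 (λ δ M s → δ :+ (M :- s) :* δ := M :* δ :+ δ :* (con 1ℚ :+ con (- 1ℚ) :* s)) refl
        upper : ∀ δ s → δ * (s - 1ℚ) ≡ 1ℚ - (1ℚ + δ * (1ℚ + (- 1ℚ) * s))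
        upper = solve 2 (λ δ s → δ :* (s :- con 1ℚ) := con 1ℚ :- (con 1ℚ :+ δ :* (con 1ℚ :+ con (- 1ℚ) :* s))) refl
        0≤v : 0ℚ ≤ v
        0≤v = subst (0ℚ ≤_) (trans (lower δ M s) (cong (_+ δ * (1ℚ + (- 1ℚ) * s)) Mδ≡1))
          (0≤+ 0≤δ (0≤* (0≤- s≤M) 0≤δ))
        0≤1-v : 0ℚ ≤ 1ℚ - v
        0≤1-v = subst (0ℚ ≤_) (upper δ s) (0≤* 0≤δ (0≤- 1≤s))

      close : ∀ x b → all (λ g → g x) gs ≡ b → ∣ c * chebT e (u x) - ⟦ b ⟧ ∣ ≤ ⅓
      close x true  pass = subst (λ q → ∣ c * chebT e q - 1ℚ ∣ ≤ ⅓)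
        (sym (trans (cong (λ s → 1ℚ + δ * (1ℚ + (- 1ℚ) * s)) (no-fails x gs pass)) (at-pass δ))) exact
      close x false fail = small (∣chebT∣≤1 e (u x)
        (at-fail δ (ι m) (fails x gs) (some-fails x gs fail) (ℚ.≤-trans (fails≤length x gs) (ι-mono gs≤m)) 0≤δ mδ≡1))

    -- The polynomial c T_e(u) is exactly 1 where all tests pass, since c is the inverse of T_e(1 +
    -- δ). Elsewhere |T_e(u)| ≤ 1, which leaves at most c ≤ 1/3.
    conjunction-degree : ApproxDegree≤ (λ x → all (λ g → g x) gs) (e ℕ.* (d ℕ.+ d))
    conjunction-degree = approximates (constant {d = 0} c *ᵈ chebT-degree u-degree e) (λ x → close x _ refl)

open import Data.Fin.Subset using (Subset; _∈_; ∣_∣; inside; outside; ⊥)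
open import Data.Fin.Subset.Properties using (∣⊥∣≡0)
open import Data.Nat.Base using (_+_; _*_; _^_; _∸_; _≤_)

-- Decision trees

data Tree (ℓ : ℕ) (A : Set) : Set where
  leaf  : A → Tree ℓ A
  query : Fin ℓ → (Bool → Tree ℓ A) → Tree ℓ A

-- Trees query descriptor bits only; the input enters through at most one literal at the end. Once a
-- descriptor is fixed, every test is a constant or a single literal on the input.
data Outcome (N : ℕ) : Set where
  verdict : Bool → Outcome N
  literal : Fin N → Bool → Outcome N

module _ {ℓ : ℕ} {A : Set} where

  run : Tree ℓ A → Vec Bool ℓ → A
  run (leaf a)    y = a
  run (query i k) y = run (k (lookup y i)) y

  data Depth≤ : ℕ → Tree ℓ A → Set where
    leaf≤  : ∀ {d a} → Depth≤ d (leaf a)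
    query≤ : ∀ {d i k} → (∀ b → Depth≤ d (k b)) → Depth≤ (suc d) (query i k)

  Depth-mono : ∀ {d e t} → d ≤ e → Depth≤ d t → Depth≤ e t
  Depth-mono d≤e         leaf≤       = leaf≤
  Depth-mono (ℕ.s≤s d≤e) (query≤ k≤) = query≤ (λ b → Depth-mono d≤e (k≤ b))

  readBits : ∀ {w} → Vec (Fin ℓ) w → (Vec Bool w → Tree ℓ A) → Tree ℓ A
  readBits []       k = k []
  readBits (i ∷ is) k = query i (λ b → readBits is (k ∘ (b ∷_)))

  run-readBits : ∀ {w} (is : Vec (Fin ℓ) w) k y → run (readBits is k) y ≡ run (k (Vec.map (lookup y) is)) y
  run-readBits []       k y = refl
  run-readBits (i ∷ is) k y = run-readBits is (k ∘ (lookup y i ∷_)) y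

  depth-readBits : ∀ {w d} (is : Vec (Fin ℓ) w) {k} → (∀ v → Depth≤ d (k v)) → Depth≤ (w + d) (readBits is k)
  depth-readBits []       k≤ = k≤ []
  depth-readBits (i ∷ is) k≤ = query≤ (λ b → depth-readBits is (λ v → k≤ (b ∷ v)))

sat : ∀ {N} → Input N → Outcome N → Bool
sat x (verdict b)   = b
sat x (literal i b) = if b then lookup x i else not (lookup x i)

⟦not⟧ : ∀ b → 1ℚ ℚ.+ (ℚ.- 1ℚ) ℚ.* ⟦ b ⟧ ≡ ⟦ not b ⟧
⟦not⟧ true  = refl
⟦not⟧ false = refl

negation-degree : ∀ {N d} {g : Input N → Bool} → HasDegree≤ (λ x → ⟦ g x ⟧) d → HasDegree≤ (λ x → ⟦ not (g x) ⟧) d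
negation-degree {g = g} p = degree-cong (λ x → ⟦not⟧ (g x)) (constant 1ℚ +ᵈ (constant {d = 0} (ℚ.- 1ℚ) *ᵈ p))

⟦if⟧ : ∀ b (q : Bool → ℚ) → ⟦ b ⟧ ℚ.* q true ℚ.+ ⟦ not b ⟧ ℚ.* q false ≡ q b
⟦if⟧ true  q = trans (cong₂ ℚ._+_ (ℚ.*-identityˡ (q true)) (ℚ.*-zeroˡ (q false))) (ℚ.+-identityʳ (q true))
⟦if⟧ false q = trans (cong₂ ℚ._+_ (ℚ.*-zeroˡ (q true)) (ℚ.*-identityˡ (q false))) (ℚ.+-identityˡ (q false))

module _ {N ℓ : ℕ} where

  lookup-take : ∀ (w : Vec Bool (N + ℓ)) i → lookup w (i Fin.↑ˡ ℓ) ≡ lookup (Vec.take N w) i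
  lookup-take w i = trans (cong (λ v → lookup v (i Fin.↑ˡ ℓ)) (sym (Vec.take++drop≡id N w)))
    (Vec.lookup-++ˡ (Vec.take N w) (Vec.drop N w) i)

  lookup-drop : ∀ (w : Vec Bool (N + ℓ)) i → lookup w (N Fin.↑ʳ i) ≡ lookup (Vec.drop N w) i
  lookup-drop w i = trans (cong (λ v → lookup v (N Fin.↑ʳ i)) (sym (Vec.take++drop≡id N w)))
    (Vec.lookup-++ʳ (Vec.take N w) (Vec.drop N w) i)

  check : Tree ℓ (Outcome N) → Input N → Vec Bool ℓ → Bool
  check t x y = sat x (run t y)

  -- A query of bit b interpolates between its branches as b · (true branch) + (1 - b) · (false
  -- branch), which raises the degree by one. The final literal accounts for the `suc`.
  tree-degree : ∀ {d t} → Depth≤ d t → HasDegree≤ (λ w → ⟦ onConcatenation (check t) w ⟧) (suc d)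
  tree-degree {t = leaf (verdict b)} leaf≤ = constant ⟦ b ⟧
  tree-degree {t = leaf (literal i true)} leaf≤ =
    degree-cong (λ w → cong ⟦_⟧ (lookup-take w i)) (variable-degree (i Fin.↑ˡ ℓ))
  tree-degree {t = leaf (literal i false)} leaf≤ =
    degree-cong (λ w → cong (⟦_⟧ ∘ not) (lookup-take w i)) (negation-degree (variable-degree (i Fin.↑ˡ ℓ)))
  tree-degree {t = query i k} (query≤ k≤) = degree-cong
    (λ w → trans (⟦if⟧ (lookup w (N Fin.↑ʳ i)) (λ b → ⟦ onConcatenation (check (k b)) w ⟧))
                 (cong (λ b → ⟦ onConcatenation (check (k b)) w ⟧) (lookup-drop w i)))
    ((variable-degree {d = 0} (N Fin.↑ʳ i) *ᵈ tree-degree (k≤ true))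
      +ᵈ (negation-degree (variable-degree {d = 0} (N Fin.↑ʳ i)) *ᵈ tree-degree (k≤ false)))

  accepts : List (Tree ℓ (Outcome N)) → Input N → Vec Bool ℓ → Bool
  accepts ts x y = all (λ t → check t x y) ts

  accepts-degree : ∀ {d} ts → All (Depth≤ d) ts → ∀ m e .{{_ : ℕ.NonZero m}} → length ts ≤ m → 2 * m ≤ e * e →
    ApproxDegree≤ (onConcatenation (accepts ts)) (e * (suc d + suc d))
  accepts-degree {d} ts ts≤ m e ts≤m 2m≤e² = approx-cong (λ w → cong and (sym (List.map-∘ ts)))
    (conjunction-degree (List.map (λ t → onConcatenation (check t)) ts) (All.map⁺ (All.map tree-degree ts≤)) m e
      (subst (_≤ m) (sym (List.length-map _ ts)) ts≤m) 2m≤e²)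
    where
    approx-cong : ∀ {M e} {g h : Input M → Bool} → (∀ w → g w ≡ h w) → ApproxDegree≤ g e → ApproxDegree≤ h e
    approx-cong g≗h (p , p≤ , p≈) = p , p≤ , λ w →
      subst (λ b → ∣ eval p (Vec.map bit w) -ᴿ bit b ∣ᴿ ≤ᴿ fromℚ ⅓) (g≗h w) (p≈ w)

  insert : Outcome N → Subset N → Subset N
  insert (verdict _)   I = I
  insert (literal i _) I = I [ i ]≔ inside

  support : List (Outcome N) → Subset N
  support = List.foldr insert ⊥

  ∣insert∣ : ∀ o I → ∣ insert o I ∣ ≤ suc ∣ I ∣
  ∣insert∣ (verdict _)   I = ℕ.n≤1+n ∣ I ∣
  ∣insert∣ (literal i _) I = ∣[]≔∣ I i
    where
    ∣[]≔∣ : ∀ {M} (I : Subset M) i → ∣ I [ i ]≔ inside ∣ ≤ suc ∣ I ∣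
    ∣[]≔∣ (inside  ∷ I) zero    = ℕ.n≤1+n _
    ∣[]≔∣ (outside ∷ I) zero    = ℕ.≤-refl
    ∣[]≔∣ (inside  ∷ I) (suc i) = ℕ.s≤s (∣[]≔∣ I i)
    ∣[]≔∣ (outside ∷ I) (suc i) = ∣[]≔∣ I i

  ∣support∣ : ∀ os → ∣ support os ∣ ≤ length os
  ∣support∣ []       = ℕ.≤-reflexive (∣⊥∣≡0 N)
  ∣support∣ (o ∷ os) = ℕ.≤-trans (∣insert∣ o (support os)) (ℕ.s≤s (∣support∣ os))

  all-sat : ∀ os x x′ → (∀ i → i ∈ support os → lookup x i ≡ lookup x′ i) → all (sat x) os ≡ true → all (sat x′) os ≡ true
  all-sat []                    x x′ agree eq = refl
  all-sat (verdict true ∷ os)   x x′ agree eq = all-sat os x x′ agree eq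
  all-sat (literal i b ∷ os)    x x′ agree eq with sat x (literal i b) in xi
  ... | true = cong₂ _∧_ (trans (cong (λ c → if b then c else not c) (sym (agree i ([]≔-updates (support os) i)))) xi)
                         (all-sat os x x′ (λ j j∈ → agree j (∈-support-insert os i j j∈)) eq)
    where
    []≔-updates : ∀ {M} (I : Subset M) i → i ∈ I [ i ]≔ inside
    []≔-updates (_ ∷ I) zero    = Vec.here
    []≔-updates (_ ∷ I) (suc i) = Vec.there ([]≔-updates I i)
    ∈-[]≔ : ∀ {M} (I : Subset M) i j → j ∈ I → j ∈ I [ i ]≔ inside
    ∈-[]≔ (_ ∷ I) zero    zero    _                = Vec.here
    ∈-[]≔ (_ ∷ I) zero    (suc j) (Vec.there j∈I) = Vec.there j∈I
    ∈-[]≔ (_ ∷ I) (suc i) zero    Vec.here         = Vec.here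
    ∈-[]≔ (_ ∷ I) (suc i) (suc j) (Vec.there j∈I) = Vec.there (∈-[]≔ I i j j∈I)
    ∈-support-insert : ∀ os i j → j ∈ support os → j ∈ support os [ i ]≔ inside
    ∈-support-insert os = ∈-[]≔ (support os)

  -- `I` collects the coordinates of the literals that the tests reach on `y`, at most one per test.
  -- Which literals are reached does not depend on the input.
  persistent : ∀ ts y → Σ[ I ∈ Subset N ] ∣ I ∣ ≤ length ts
    × (∀ x x′ → (∀ i → i ∈ I → lookup x i ≡ lookup x′ i) → accepts ts x y ≡ true → accepts ts x′ y ≡ true)
  persistent ts y = support os , subst (∣ support os ∣ ≤_) (List.length-map (λ t → run t y) ts) (∣support∣ os)
    , λ x x′ agree eq → trans (cong and (List.map-∘ ts))
        (all-sat os x x′ agree (trans (cong and (sym (List.map-∘ ts))) eq))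
    where
    os = List.map (λ t → run t y) ts

-- Certificate complexity

∈-allVectors : ∀ {A : Set} {as : List A} → (∀ a → a List.∈ as) → ∀ {N} (v : Vec A N) → v List.∈ allVectors as N
∈-allVectors a∈ []      = here refl
∈-allVectors a∈ (a ∷ v) = ∈-cartesianProductWith⁺ _∷_ (a∈ a) (∈-allVectors a∈ v)

∈-allInputs : ∀ {N} (x : Input N) → x List.∈ allInputs N
∈-allInputs = ∈-allVectors λ { false → here refl ; true → there (here refl) }

∈-allAssignments : ∀ {N} (ρ : PartialAssignment N) → ρ List.∈ allAssignments N
∈-allAssignments = ∈-allVectors λ { nothing → here refl ; (just false) → there (here refl) ; (just true) → there (there (here refl)) }

∃-input? : ∀ {N} {P : Input N → Set} → Decidable P → Dec (∃[ x ] P x)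
∃-input? P? = map′ Any.satisfied (λ (x , px) → List.lose (∈-allInputs x) px) (Any.any? P? (allInputs _))

module _ {N} (Σ : List Value) (f : PartialFunction N) where

  -- The bound `m ≤ N` covers the default value `N` of the minimum.
  C-at-≥ : ∀ {x m} → m ≤ N → (∀ ρ → Certificate Σ f x ρ → m ≤ size ρ) → m ≤ C-at Σ f x
  C-at-≥ {x} m≤N m≤ = v≤min⁺ m≤N (All.map⁺ (All.tabulate
    (λ {ρ} ρ∈ → m≤ ρ (proj₂ (∈-filter⁻ (certificate? Σ f x) {xs = allAssignments N} ρ∈)))))

  C-at-≤ : ∀ {x ρ} → Certificate Σ f x ρ → C-at Σ f x ≤ size ρ
  C-at-≤ {x} {ρ} cert = All.lookup (min≤xs N _) (∈-map⁺ size (∈-filter⁺ (certificate? Σ f x) (∈-allAssignments ρ) cert))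

  C-max-≥ : ∀ {x} → Any (f x ≡_) Σ → C-at Σ f x ≤ C-max Σ f
  C-max-≥ {x} fx∈ = All.lookup (xs≤max 0 _) (∈-map⁺ (C-at Σ f) (∈-filter⁺ _ (∈-allInputs x) fx∈))

  C-max-≤ : ∀ {m} → (∀ x → Any (f x ≡_) Σ → C-at Σ f x ≤ m) → C-max Σ f ≤ m
  C-max-≤ ≤m = max≤v⁺ ℕ.z≤n (All.map⁺ (All.tabulate (λ {x} x∈ → ≤m x (proj₂ (∈-filter⁻ _ {xs = allInputs N} x∈)))))

Fixes : ∀ {N} → PartialAssignment N → Fin N → Set
Fixes ρ i = ∃[ b ] lookup ρ i ≡ just b

fixes? : ∀ {N} (ρ : PartialAssignment N) → Decidable (Fixes ρ)
fixes? ρ i with lookup ρ i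
... | just b  = yes (b , refl)
... | nothing = no λ ()

consistent-agree : ∀ {N} {ρ : PartialAssignment N} {x x′} → Consistent ρ x →
  (∀ i → Fixes ρ i → lookup x i ≡ lookup x′ i) → Consistent ρ x′
consistent-agree {x′ = []}     []                        agree = []
consistent-agree {x′ = _ ∷ _} (Maybe.nothing   ∷ ρx)  agree = Maybe.nothing ∷ consistent-agree ρx (λ i → agree (suc i))
consistent-agree {x′ = _ ∷ _} (Maybe.just refl ∷ ρx) agree =
  Maybe.just (agree zero (_ , refl)) ∷ consistent-agree ρx (λ i → agree (suc i))

-- The position of `i` among the fixed coordinates. It turns lower bounds on `size` into the
-- pigeonhole principle for `Fin`.
rank : ∀ {N} (ρ : PartialAssignment N) i → Fixes ρ i → Fin (size ρ)
rank (just _  ∷ ρ) zero    fix = zero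
rank (just _  ∷ ρ) (suc i) fix = suc (rank ρ i fix)
rank (nothing ∷ ρ) (suc i) fix = rank ρ i fix

rank-injective : ∀ {N} (ρ : PartialAssignment N) {i j} p q → rank ρ i p ≡ rank ρ j q → i ≡ j
rank-injective (just _  ∷ ρ) {zero}  {zero}  p q eq = refl
rank-injective (just _  ∷ ρ) {suc i} {suc j} p q eq = cong suc (rank-injective ρ p q (Fin.suc-injective eq))
rank-injective (nothing ∷ ρ) {suc i} {suc j} p q eq = cong suc (rank-injective ρ p q eq)

size-≥ : ∀ {N m} (ρ : PartialAssignment N) (g : Fin m → Fin N) → Injective _≡_ _≡_ g → (∀ a → Fixes ρ (g a)) → m ≤ size ρ
size-≥ ρ g g-inj fix = Fin.injective⇒≤ {f = λ a → rank ρ (g a) (fix a)} (λ eq → g-inj (rank-injective ρ (fix _) (fix _) eq))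

restrict : ∀ {N} → Subset N → Input N → PartialAssignment N
restrict = Vec.zipWith (λ s b → if s then just b else nothing)

size-restrict : ∀ {N} (I : Subset N) x → size (restrict I x) ≡ ∣ I ∣
size-restrict []            []      = refl
size-restrict (inside  ∷ I) (b ∷ x) = cong suc (size-restrict I x)
size-restrict (outside ∷ I) (b ∷ x) = size-restrict I x

restrict-consistent : ∀ {N} (I : Subset N) x → Consistent (restrict I x) x
restrict-consistent []            []      = []
restrict-consistent (inside  ∷ I) (b ∷ x) = Maybe.just refl ∷ restrict-consistent I x
restrict-consistent (outside ∷ I) (b ∷ x) = Maybe.nothing ∷ restrict-consistent I x

restrict-agree : ∀ {N} (I : Subset N) x {x′} → Consistent (restrict I x) x′ → ∀ i → i ∈ I → lookup x i ≡ lookup x′ i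
restrict-agree (inside ∷ I) (b ∷ x) {_ ∷ _} (Maybe.just eq ∷ _) zero _                = eq
restrict-agree (_ ∷ I)      (b ∷ x) {_ ∷ _} (_ ∷ ρx)         (suc i) (Vec.there i∈I) = restrict-agree I x ρx i i∈I

-- The partial function given by two disjoint predicates

module Described {N ℓ} (φ : Bool → Input N → Vec Bool ℓ → Bool)
  (disjoint : ∀ {x y y′} → φ true x y ≡ true → φ false x y′ ≡ true → Empty.⊥) where

  described? : ∀ b x → Dec (∃[ y ] φ b x y ≡ true)
  described? b x = ∃-input? (λ y → φ b x y Bool.≟ true)

  -- The function searches through all descriptors. It is sealed, so that later arguments see only
  -- the three properties below and never unfold the search.
  abstract

    f : PartialFunction N
    f x with described? true x | described? false x
    ... | yes _ | _     = just true
    ... | no _  | yes _ = just false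
    ... | no _  | no _  = nothing

    f-just : ∀ b x → f x ≡ just b → ∃[ y ] φ b x y ≡ true
    f-just b x eq with described? true x | described? false x
    f-just .true  x refl | yes p | _     = p
    f-just .false x refl | no _  | yes q = q

    f-described : ∀ b x y → φ b x y ≡ true → f x ≡ just b
    f-described b x y eq with described? true x | described? false x
    f-described true  x y eq | yes _        | _     = refl
    f-described false x y eq | yes (_ , eq′) | _    = ⊥-elim (disjoint eq′ eq)
    f-described true  x y eq | no ¬p        | _     = ⊥-elim (¬p (y , eq))
    f-described false x y eq | no _         | yes _ = refl
    f-described false x y eq | no _         | no ¬q = ⊥-elim (¬q (y , eq))

    f-nothing : ∀ x → (∀ b y → ¬ (φ b x y ≡ true)) → f x ≡ nothing
    f-nothing x none with described? true x | described? false x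
    ... | yes (y , eq) | _            = ⊥-elim (none true y eq)
    ... | no _         | yes (y , eq) = ⊥-elim (none false y eq)
    ... | no _         | no _         = refl

  module _ {m} (persists : ∀ b y → Σ[ I ∈ Subset N ] ∣ I ∣ ≤ m
      × (∀ x x′ → (∀ i → i ∈ I → lookup x i ≡ lookup x′ i) → φ b x y ≡ true → φ b x′ y ≡ true)) where

    -- Fixing the coordinates in `I` as in `x` gives a certificate, because every completion is
    -- accepted with the same descriptor `y`.
    C-max-≤-persists : ∀ b → C-max (just b ∷ []) f ≤ m
    C-max-≤-persists b = C-max-≤ (just b ∷ []) f λ { x (here fx≡b) → bound x (f-just b x fx≡b) }
      where
      bound : ∀ x → ∃[ y ] φ b x y ≡ true → C-at (just b ∷ []) f x ≤ m
      bound x (y , eq) with persists b y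
      ... | I , ∣I∣≤m , keep = ℕ.≤-trans (C-at-≤ (just b ∷ []) f (restrict-consistent I x
            , λ x′ ρx′ → here (f-described b x′ y (keep x x′ (restrict-agree I x ρx′) eq))))
          (subst (_≤ m) (sym (size-restrict I x)) ∣I∣≤m)

    C-≤ : C f ≤ m
    C-≤ = ℕ.⊔-lub (C-max-≤-persists false) (C-max-≤-persists true)

-- Labellings of the tree

∑ : {A : Set} → List A → (A → ℕ) → ℕ
∑ []       f = 0
∑ (x ∷ xs) f = f x + ∑ xs f

module _ {A : Set} where

  ∑-cong : ∀ (xs : List A) {f g : A → ℕ} → (∀ x → f x ≡ g x) → ∑ xs f ≡ ∑ xs g
  ∑-cong []       f≗g = refl
  ∑-cong (x ∷ xs) f≗g = cong₂ _+_ (f≗g x) (∑-cong xs f≗g)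

  ∑-mono : ∀ {xs : List A} {f g : A → ℕ} → All (λ x → f x ≤ g x) xs → ∑ xs f ≤ ∑ xs g
  ∑-mono []           = ℕ.z≤n
  ∑-mono (fx≤ ∷ f≤g) = ℕ.+-mono-≤ fx≤ (∑-mono f≤g)

  ∑-const : ∀ (xs : List A) c → ∑ xs (λ _ → c) ≡ length xs * c
  ∑-const []       c = refl
  ∑-const (x ∷ xs) c = cong (c +_) (∑-const xs c)

  ∑-++ : ∀ (xs : List A) {ys f} → ∑ (xs ++ ys) f ≡ ∑ xs f + ∑ ys f
  ∑-++ []       = refl
  ∑-++ (x ∷ xs) {f = f} = trans (cong (f x +_) (∑-++ xs)) (sym (ℕ.+-assoc (f x) _ _))

  ∑-+ : ∀ (xs : List A) f g → ∑ xs (λ x → f x + g x) ≡ ∑ xs f + ∑ xs g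
  ∑-+ []       f g = refl
  ∑-+ (x ∷ xs) f g = trans (cong (f x + g x +_) (∑-+ xs f g)) (ℕ-interchange (f x) (g x) (∑ xs f) (∑ xs g))

  ∑-*ˡ : ∀ (xs : List A) c f → ∑ xs (λ x → c * f x) ≡ c * ∑ xs f
  ∑-*ˡ []       c f = sym (ℕ.*-zeroʳ c)
  ∑-*ˡ (x ∷ xs) c f = trans (cong (c * f x +_) (∑-*ˡ xs c f)) (sym (ℕ.*-distribˡ-+ c (f x) (∑ xs f)))

  ∑-*ʳ : ∀ (xs : List A) c f → ∑ xs (λ x → f x * c) ≡ ∑ xs f * c
  ∑-*ʳ xs c f = trans (∑-cong xs (λ x → ℕ.*-comm (f x) c)) (trans (∑-*ˡ xs c f) (ℕ.*-comm c (∑ xs f)))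

  term≤∑ : ∀ {xs : List A} {x} f → x List.∈ xs → f x ≤ ∑ xs f
  term≤∑ f (here refl) = ℕ.m≤m+n _ _
  term≤∑ f (there x∈)  = ℕ.≤-trans (term≤∑ f x∈) (ℕ.m≤n+m _ _)

  ∑≤⇒some≤ : ∀ (xs : List A) f b .{{_ : ℕ.NonZero (length xs)}} → ∑ xs f ≤ length xs * b → ∃[ x ] f x ≤ b
  ∑≤⇒some≤ xs f b ∑≤ with Any.any? (λ x → f x ℕ.≤? b) xs
  ... | yes some = Any.satisfied some
  ... | no  none = contradiction (ℕ.≤-trans (∑-mono (All.map ℕ.≰⇒> (All.¬Any⇒All¬ xs none))) ∑≤)
    (ℕ.<⇒≱ (subst (length xs * b ℕ.<_) (sym (∑-const xs (suc b))) (ℕ.*-monoʳ-< (length xs) (ℕ.n<1+n b))))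

module _ {A B : Set} where

  ∑-swap : ∀ (xs : List A) (ys : List B) (f : A → B → ℕ) → ∑ xs (λ x → ∑ ys (f x)) ≡ ∑ ys (λ y → ∑ xs (λ x → f x y))
  ∑-swap []       ys f = sym (trans (∑-const ys 0) (ℕ.*-zeroʳ (length ys)))
  ∑-swap (x ∷ xs) ys f = trans (cong (∑ ys (f x) +_) (∑-swap xs ys f)) (sym (∑-+ ys (f x) _))

  ∑-map : ∀ (g : A → B) xs f → ∑ (List.map g xs) f ≡ ∑ xs (f ∘ g)
  ∑-map g []       f = refl
  ∑-map g (x ∷ xs) f = cong (f (g x) +_) (∑-map g xs f)

∑-product : ∀ {A B C : Set} (g : A → B → C) xs ys f → ∑ (cartesianProductWith g xs ys) f ≡ ∑ xs (λ x → ∑ ys (f ∘ g x))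
∑-product g []       ys f = refl
∑-product g (x ∷ xs) ys f = trans (∑-++ (List.map (g x) ys)) (cong₂ _+_ (∑-map (g x) ys f) (∑-product g xs ys f))

length-product : ∀ {A B C : Set} (g : A → B → C) xs ys → length (cartesianProductWith g xs ys) ≡ length xs * length ys
length-product g []       ys = refl
length-product g (x ∷ xs) ys = trans (List.length-++ (List.map (g x) ys))
  (cong₂ _+_ (List.length-map (g x) ys) (length-product g xs ys))

length-allVectors : ∀ {A : Set} (as : List A) N → length (allVectors as N) ≡ length as ^ N
length-allVectors as zero    = refl
length-allVectors as (suc N) = trans (length-product _∷_ as (allVectors as N)) (cong (length as *_) (length-allVectors as N))

-- A node of the binary tree is the list of the turns on the way from the root, the last turn first.
Node : Set
Node = List Bool

module Labelling (n : ℕ) where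

  Label : Set
  Label = Vec (Fin n) 4

  Labels : Set
  Labels = Node → Label

  hit : ∀ {m} → Vec Bool n → Vec (Fin n) m → Bool
  hit R []      = false
  hit R (r ∷ l) = if lookup R r then true else hit R l

  unflagged : Vec Bool n → List (Fin n)
  unflagged R = filter (λ r → lookup R r Bool.≟ false) (allFin n)

  -- L is applied to nodes read from the root here, so that deleting the first turn restricts it to a subtree.
  survivors# : Vec Bool n → Labels → ℕ → ℕ
  survivors# R L zero    = 0
  survivors# R L (suc h) =
    if hit R (L []) then 0 else suc (survivors# R (L ∘ (false ∷_)) h + survivors# R (L ∘ (true ∷_)) h)

  glue : Label → Labels × Labels → Labels
  glue l (L₀ , L₁) []          = l
  glue l (L₀ , L₁) (false ∷ p) = L₀ p
  glue l (L₀ , L₁) (true  ∷ p) = L₁ p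

  labels : List Label
  labels = allVectors (allFin n) 4

  module _ (r₀ : Fin n) where

    -- The sample space of the random labelling, up to depth `h`: the root label and the labellings
    -- of the two subtrees range independently. Deeper nodes carry a default label, which
    -- `survivors#` at height `h` never reads.
    labellings : ℕ → List Labels
    labellings zero    = (λ _ → Vec.replicate 4 r₀) ∷ []
    labellings (suc h) = cartesianProductWith glue labels (cartesianProduct (labellings h) (labellings h))

    length-labellings : ∀ h → length (labellings (suc h)) ≡ length labels * (length (labellings h) * length (labellings h))
    length-labellings h = trans (length-product glue labels _) (cong (length labels *_) (length-product _,_ (labellings h) (labellings h)))

    weight : Vec Bool n → Labels → ℕ → ℕ
    weight R L h = 4 ^ survivors# R L h

    misses : ∀ {m} → Vec Bool n → Vec (Fin n) m → ℕ
    misses R l = if hit R l then 0 else 1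

    ∑-misses : ∀ R m → ∑ (allVectors (allFin n) m) (misses R) ≡ length (unflagged R) ^ m
    ∑-misses R zero    = refl
    ∑-misses R (suc m) = begin
      ∑ (allVectors (allFin n) (suc m)) (misses R)                ≡⟨ ∑-product _∷_ (allFin n) vs (misses R) ⟩
      ∑ (allFin n) (λ r → ∑ vs (λ l → misses R (r ∷ l)))          ≡⟨ ∑-cong (allFin n) (λ r → trans (∑-cong vs (split r)) (∑-*ˡ vs (single-miss r) (misses R))) ⟩
      ∑ (allFin n) (λ r → single-miss r * ∑ vs (misses R))        ≡⟨ ∑-*ʳ (allFin n) (∑ vs (misses R)) single-miss ⟩
      ∑ (allFin n) single-miss * ∑ vs (misses R)                  ≡⟨ cong₂ _*_ (count (allFin n)) (∑-misses R m) ⟩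
      length (unflagged R) * length (unflagged R) ^ m             ∎
      where
      open ≡-Reasoning
      vs = allVectors (allFin n) m
      single-miss : Fin n → ℕ
      single-miss r = if lookup R r then 0 else 1
      split : ∀ r l → misses R (r ∷ l) ≡ single-miss r * misses R l
      split r l with lookup R r
      ... | true  = refl
      ... | false = sym (ℕ.*-identityˡ (misses R l))
      count : ∀ rs → ∑ rs single-miss ≡ length (filter (λ r → lookup R r Bool.≟ false) rs)
      count []       = refl
      count (r ∷ rs) with lookup R r
      ... | true  = count rs
      ... | false = cong suc (count rs)

    module _ (R : Vec Bool n) (few : 2 * length (unflagged R) ≤ n) where

      private
        K = length labels
        a = ∑ labels (misses R)

      -- Each of the four rows of a random label is unflagged with probability at most 1/2, so the
      -- label is missed with probability q ≤ 1/16. This decides the number of rows in a label: 1 +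
      -- 4 q x² ≤ x has a positive solution exactly when 16 q ≤ 1.
      16a≤K : 16 * a ≤ K
      16a≤K = begin
        16 * a          ≡⟨ cong (16 *_) (∑-misses R 4) ⟩
        16 * c ^ 4      ≡⟨ ℕ-Solver.solve 1 (λ c → con′ 16 :*′ c :^′ 4 :=′ (con′ 2 :*′ c) :^′ 4) refl c ⟩
        (2 * c) ^ 4     ≤⟨ ℕ.^-monoˡ-≤ 4 few ⟩
        n ^ 4           ≡⟨ cong (_^ 4) (List.length-tabulate {n = n} (λ i → i)) ⟨
        length (allFin n) ^ 4 ≡⟨ length-allVectors (allFin n) 4 ⟨
        K               ∎
        where
        open ℕ.≤-Reasoning
        open ℕ-Solver using () renaming (con to con′; _:*_ to _:*′_; _:^_ to _:^′_; _:=_ to _:=′_)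
        c = length (unflagged R)

      total : ℕ → ℕ
      total h = ∑ (labellings h) (λ L → weight R L h)

      -- If the root label is hit, each of the `M * M` pairs of subtree labellings has weight 1. If
      -- it is missed, the weight is 4 times the product of the subtree weights, and the sum over
      -- pairs factors. The first contribution is charged to all labels.
      total-suc : ∀ h → total (suc h) ≤ K * (length (labellings h) * length (labellings h)) + a * (4 * (total h * total h))
      total-suc h = begin
        total (suc h)
          ≡⟨ ∑-product glue labels _ (λ L → weight R L (suc h)) ⟩
        ∑ labels (λ l → ∑ (cartesianProduct Ls Ls) (λ L → weight R (glue l L) (suc h)))
          ≤⟨ ∑-mono {xs = labels} (All.tabulate (λ {l} _ → at-label l)) ⟩
        ∑ labels (λ l → M * M + misses R l * (4 * (total h * total h)))
          ≡⟨ ∑-+ labels (λ _ → M * M) _ ⟩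
        ∑ labels (λ _ → M * M) + ∑ labels (λ l → misses R l * (4 * (total h * total h)))
          ≡⟨ cong₂ _+_ (∑-const labels (M * M)) (∑-*ʳ labels (4 * (total h * total h)) (misses R)) ⟩
        K * (M * M) + a * (4 * (total h * total h)) ∎
        where
        open ℕ.≤-Reasoning
        Ls = labellings h
        M = length Ls
        at-label : ∀ l → ∑ (cartesianProduct Ls Ls) (λ L → weight R (glue l L) (suc h)) ≤ M * M + misses R l * (4 * (total h * total h))
        at-label l with hit R l
        ... | true  = ℕ.≤-trans (ℕ.≤-reflexive (trans (∑-const (cartesianProduct Ls Ls) 1)
                        (trans (ℕ.*-identityʳ _) (length-product _,_ Ls Ls)))) (ℕ.m≤m+n (M * M) 0)
        ... | false = ℕ.≤-trans (ℕ.≤-reflexive (begin-equality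
            ∑ (cartesianProduct Ls Ls) (λ (L₀ , L₁) → 4 ^ suc (survivors# R L₀ h + survivors# R L₁ h))
              ≡⟨ ∑-product _,_ Ls Ls _ ⟩
            ∑ Ls (λ L₀ → ∑ Ls (λ L₁ → 4 * 4 ^ (survivors# R L₀ h + survivors# R L₁ h)))
              ≡⟨ ∑-cong Ls (λ L₀ → trans (∑-*ˡ Ls 4 _) (cong (4 *_) (trans
                   (∑-cong Ls (λ L₁ → ℕ.^-distribˡ-+-* 4 (survivors# R L₀ h) (survivors# R L₁ h)))
                   (∑-*ˡ Ls (weight R L₀ h) (λ L₁ → weight R L₁ h))))) ⟩
            ∑ Ls (λ L₀ → 4 * (weight R L₀ h * total h))
              ≡⟨ trans (∑-*ˡ Ls 4 _) (cong (4 *_) (∑-*ʳ Ls (total h) (λ L₀ → weight R L₀ h))) ⟩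
            4 * (total h * total h)
              ≡⟨ ℕ.*-identityˡ _ ⟨
            1 * (4 * (total h * total h)) ∎)) (ℕ.m≤n+m _ (M * M))

      -- If labels are missed with probability q ≤ 1/16, a bound x on the mean of 4 ^ survivors# reproduces
      -- itself as soon as 1 + 4 q x² ≤ x, as for x = 2.
      total≤ : ∀ h → total h ≤ length (labellings h) * 2
      total≤ zero    = ℕ.n≤1+n 1
      total≤ (suc h) = begin
        total (suc h)                                      ≤⟨ total-suc h ⟩
        K * (M * M) + a * (4 * (total h * total h))        ≤⟨ ℕ.+-monoʳ-≤ (K * (M * M)) (ℕ.*-monoʳ-≤ a (ℕ.*-monoʳ-≤ 4 (ℕ.*-mono-≤ (total≤ h) (total≤ h)))) ⟩
        K * (M * M) + a * (4 * ((M * 2) * (M * 2)))        ≡⟨ rearrange K M a ⟩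
        K * (M * M) + 16 * a * (M * M)                     ≤⟨ ℕ.+-monoʳ-≤ (K * (M * M)) (ℕ.*-monoˡ-≤ (M * M) 16a≤K) ⟩
        K * (M * M) + K * (M * M)                          ≡⟨ double (K * (M * M)) ⟩
        K * (M * M) * 2                                    ≡⟨ cong (_* 2) (length-labellings h) ⟨
        length (labellings (suc h)) * 2                    ∎
        where
        open ℕ.≤-Reasoning
        M = length (labellings h)
        open ℕ-Solver using () renaming (con to con′; _:*_ to _:*′_; _:+_ to _:+′_; _:=_ to _:=′_)
        rearrange : ∀ K M a → K * (M * M) + a * (4 * ((M * 2) * (M * 2))) ≡ K * (M * M) + 16 * a * (M * M)
        rearrange = ℕ-Solver.solve 3 (λ K M a → K :*′ (M :*′ M) :+′ a :*′ (con′ 4 :*′ ((M :*′ con′ 2) :*′ (M :*′ con′ 2)))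
          :=′ K :*′ (M :*′ M) :+′ con′ 16 :*′ a :*′ (M :*′ M)) refl
        double : ∀ x → x + x ≡ x * 2
        double = ℕ-Solver.solve 1 (λ x → x :+′ x :=′ x :*′ con′ 2) refl

    labellings≢0 : ∀ h → ℕ.NonZero (length (labellings h))
    labellings≢0 h = ℕ.>-nonZero (nonempty h)
      where
      labels>0 : 0 ℕ.< length labels
      labels>0 = subst (0 ℕ.<_) (sym (trans (length-allVectors (allFin n) 4) (cong (_^ 4) (List.length-tabulate {n = n} (λ i → i)))))
        (ℕ.m^n>0 n {{ℕ.>-nonZero (ℕ.≤-<-trans ℕ.z≤n (Fin.toℕ<n r₀))}} 4)
      nonempty : ∀ h → 0 ℕ.< length (labellings h)
      nonempty zero    = ℕ.s≤s ℕ.z≤n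
      nonempty (suc h) = subst (0 ℕ.<_) (sym (length-labellings h)) (ℕ.*-mono-< labels>0 (ℕ.*-mono-< (nonempty h) (nonempty h)))

    -- A union bound in the form of an average: some labelling has total weight at most 2 · 2^n over
    -- all admissible `R` together, hence at most that for each of them.
    labelling-exists : ∀ h → ∃[ L ] ∀ R → 2 * length (unflagged R) ≤ n → survivors# R L h ≤ n
    labelling-exists h = L , bound
      where
      few? : Decidable (λ R → 2 * length (unflagged R) ≤ n)
      few? R = 2 * length (unflagged R) ℕ.≤? n
      Rs = filter few? (allInputs n)
      sum : Labels → ℕ
      sum L = ∑ Rs (λ R → weight R L h)
      average : ∑ (labellings h) sum ≤ length (labellings h) * (2 * 2 ^ n)
      average = begin
        ∑ (labellings h) sum                           ≡⟨ ∑-swap (labellings h) Rs (λ L R → weight R L h) ⟩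
        ∑ Rs (λ R → ∑ (labellings h) (λ L → weight R L h)) ≤⟨ ∑-mono {xs = Rs} (All.tabulate (λ {R} R∈ → total≤ R (proj₂ (∈-filter⁻ few? {xs = allInputs n} R∈)) h)) ⟩
        ∑ Rs (λ _ → length (labellings h) * 2)         ≡⟨ ∑-const Rs _ ⟩
        length Rs * (length (labellings h) * 2)        ≤⟨ ℕ.*-monoˡ-≤ _ (List.length-filter few? (allInputs n)) ⟩
        length (allInputs n) * (length (labellings h) * 2) ≡⟨ cong (_* (length (labellings h) * 2)) (length-allVectors (false ∷ true ∷ []) n) ⟩
        2 ^ n * (length (labellings h) * 2)            ≡⟨ ℕ.*-comm (2 ^ n) _ ⟩
        length (labellings h) * 2 * 2 ^ n              ≡⟨ ℕ.*-assoc (length (labellings h)) 2 (2 ^ n) ⟩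
        length (labellings h) * (2 * 2 ^ n)            ∎
        where open ℕ.≤-Reasoning
      found = ∑≤⇒some≤ (labellings h) sum (2 * 2 ^ n) {{labellings≢0 h}} average
      L = proj₁ found
      n>0 : 1 ≤ n
      n>0 = ℕ.≤-<-trans ℕ.z≤n (Fin.toℕ<n r₀)
      bound : ∀ R → 2 * length (unflagged R) ≤ n → survivors# R L h ≤ n
      -- More than `n` survivors would weigh more than 4^n, whereas 2 · 2^n ≤ 4^n because n ≥ 1.
      bound R few = ℕ.≮⇒≥ λ n<s → ℕ.<⇒≱ (ℕ.^-monoʳ-< 4 (ℕ.s≤s (ℕ.s≤s ℕ.z≤n)) n<s) (begin
        weight R L h       ≤⟨ term≤∑ (λ R → weight R L h) (∈-filter⁺ few? (∈-allInputs R) few) ⟩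
        sum L              ≤⟨ proj₂ found ⟩
        2 ^ (1 + n)        ≤⟨ ℕ.^-monoʳ-≤ 2 (ℕ.+-monoˡ-≤ n n>0) ⟩
        2 ^ (n + n)        ≡⟨ ℕ.^-distribˡ-+-* 2 n n ⟩
        2 ^ n * 2 ^ n      ≡⟨ square n ⟩
        4 ^ n              ∎)
        where
        open ℕ.≤-Reasoning
        square : ∀ n → 2 ^ n * 2 ^ n ≡ 4 ^ n
        square n = trans (sym (ℕ.^-distribˡ-+-* 2 n n)) (trans (cong (2 ^_) (cong (n +_) (sym (ℕ.+-identityʳ n)))) (sym (ℕ.^-*-assoc 2 2 n)))

  -- A `Node` has its last turn first, while a labelling is indexed from the root; hence the
  -- reversal.
  label : Labels → Node → Label
  label L p = L (p ʳ++ [])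

  module _ (R : Vec Bool n) (L : Labels) where

    survivors : ℕ → Node → List Node
    survivors zero    p = []
    survivors (suc h) p = if hit R (label L p) then [] else p ∷ survivors h (false ∷ p) ++ survivors h (true ∷ p)

    length-survivors : ∀ h p → length (survivors h p) ≡ survivors# R (λ q → L (p ʳ++ q)) h
    length-survivors zero    p = refl
    length-survivors (suc h) p with hit R (label L p)
    ... | true  = refl
    ... | false = cong suc (trans (List.length-++ (survivors h (false ∷ p)))
                                  (cong₂ _+_ (length-survivors h (false ∷ p)) (length-survivors h (true ∷ p))))

    root-survives : ∀ h p → hit R (label L p) ≡ false → p List.∈ survivors (suc h) p
    root-survives h p alive rewrite alive = here refl

    -- The list is closed under unflagged children above the cutoff, and `h + length p` is the first
    -- depth that is cut off.
    child-survives : ∀ h p q s → q List.∈ survivors h p → suc (length q) ℕ.< h + length p →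
      hit R (label L (s ∷ q)) ≡ false → (s ∷ q) List.∈ survivors h p
    child-survives (suc h) p q s q∈ short alive with hit R (label L p)
    -- At height 1 the list is just `p`, whose children already lie at the cutoff.
    child-survives (suc zero)    p q s (here refl) short alive | false = contradiction short (ℕ.<-irrefl refl)
    child-survives (suc (suc h)) p q false (here refl) short alive | false =
      there (∈-++⁺ˡ (root-survives h (false ∷ q) alive))
    child-survives (suc (suc h)) p q true  (here refl) short alive | false =
      there (∈-++⁺ʳ (survivors (suc h) (false ∷ q)) (root-survives h (true ∷ q) alive))
    child-survives (suc h) p q s (there q∈) short alive | false with ∈-++⁻ (survivors h (false ∷ p)) q∈
    ... | inj₁ q∈₀ = there (∈-++⁺ˡ (child-survives h (false ∷ p) q s q∈₀ short′ alive))
      where short′ = subst (suc (length q) ℕ.<_) (sym (ℕ.+-suc h (length p))) short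
    ... | inj₂ q∈₁ = there (∈-++⁺ʳ (survivors h (false ∷ p)) (child-survives h (true ∷ p) q s q∈₁ short′ alive))
      where short′ = subst (suc (length q) ℕ.<_) (sym (ℕ.+-suc h (length p))) short

    length-survivor : ∀ h p q → q List.∈ survivors h p → length q ℕ.< h + length p
    length-survivor (suc h) p q q∈ with hit R (label L p)
    length-survivor (suc h) p q (here refl) | false = ℕ.s≤s (ℕ.m≤n+m (length q) h)
    length-survivor (suc h) p q (there q∈)  | false with ∈-++⁻ (survivors h (false ∷ p)) q∈
    ... | inj₁ q∈₀ = subst (length q ℕ.<_) (ℕ.+-suc h (length p)) (length-survivor h (false ∷ p) q q∈₀)
    ... | inj₂ q∈₁ = subst (length q ℕ.<_) (ℕ.+-suc h (length p)) (length-survivor h (true ∷ p) q q∈₁)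

    -- The position matters: the root check looks only at the word `origin`, the one with index 0.
    root-listed-first : ∀ h p → hit R (label L p) ≡ false → ∃[ S ] survivors (suc h) p ≡ p ∷ S
    root-listed-first h p alive rewrite alive = _ , refl

-- Words and addresses

-- Decoding is total, so every bit string is a legal word and the predicates contain no test for
-- well-formedness. Only values satisfying `P` have to be encodable.
record Code (A : Set) (P : A → Set) (w : ℕ) : Set where
  field
    decode : Vec Bool w → A
    encode : ∀ a → P a → ∃[ v ] decode v ≡ a
open Code

infixr 4 _⊗_
_⊗_ : ∀ {A B P Q v w} → Code A P v → Code B Q w → Code (A × B) (λ (a , b) → P a × Q b) (v + w)
decode (_⊗_ {v = v} α β) u = α .decode (Vec.take v u) , β .decode (Vec.drop v u)
encode (_⊗_ {v = v} α β) (a , b) (pa , qb) with α .encode a pa | β .encode b qb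
... | s , refl | t , refl = s Vec.++ t , cong₂ (λ s t → α .decode s , β .decode t) (proj₁ eq) (proj₂ eq)
  where
  eq = Vec.++-injective (Vec.take v (s Vec.++ t)) s (Vec.take++drop≡id v (s Vec.++ t))

bitCode : Code Bool (λ _ → ⊤) 1
decode bitCode (b ∷ []) = b
encode bitCode b _ = b ∷ [] , refl

bool→fin : Bool → Fin 2
bool→fin false = zero
bool→fin true  = suc zero

fin→bool : Fin 2 → Bool
fin→bool zero    = false
fin→bool (suc _) = true

fin→bool→fin : ∀ i → bool→fin (fin→bool i) ≡ i
fin→bool→fin zero       = refl
fin→bool→fin (suc zero) = refl

bits→fin : ∀ {k} → Vec Bool k → Fin (2 ^ k)
bits→fin []      = zero
bits→fin (b ∷ v) = combine (bool→fin b) (bits→fin v)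

fin→bits : ∀ k → Fin (2 ^ k) → Vec Bool k
fin→bits zero    _ = []
fin→bits (suc k) i = fin→bool (proj₁ (remQuot {2} (2 ^ k) i)) ∷ fin→bits k (proj₂ (remQuot {2} (2 ^ k) i))

fin→bits→fin : ∀ k i → bits→fin (fin→bits k i) ≡ i
fin→bits→fin zero    zero = refl
fin→bits→fin (suc k) i    = trans
  (cong₂ combine (fin→bool→fin (proj₁ (remQuot {2} (2 ^ k) i))) (fin→bits→fin k (proj₂ (remQuot {2} (2 ^ k) i))))
  (Fin.combine-remQuot {2} (2 ^ k) i)

bool→fin-injective : ∀ {b c} → bool→fin b ≡ bool→fin c → b ≡ c
bool→fin-injective {false} {false} _ = refl
bool→fin-injective {true}  {true}  _ = refl

bits→fin-injective : ∀ {k} (u v : Vec Bool k) → bits→fin u ≡ bits→fin v → u ≡ v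
bits→fin-injective []      []      _  = refl
bits→fin-injective (b ∷ u) (c ∷ v) eq with Fin.combine-injective (bool→fin b) (bits→fin u) (bool→fin c) (bits→fin v) eq
... | b≡c , u≡v = cong₂ _∷_ (bool→fin-injective b≡c) (bits→fin-injective u v u≡v)

finCode : ∀ k → Code (Fin (2 ^ k)) (λ _ → ⊤) k
decode (finCode k) = bits→fin
encode (finCode k) i _ = fin→bits k i , fin→bits→fin k i

-- Two bits per level, one saying whether the path continues and one for the turn, so that nodes of
-- all depths up to `d` share one word length.
bits→node : ∀ d → Vec Bool (d * 2) → Node
bits→node zero    []              = []
bits→node (suc d) (false ∷ _ ∷ v) = []
bits→node (suc d) (true  ∷ b ∷ v) = b ∷ bits→node d v

node→bits : ∀ d p → length p ≤ d → ∃[ v ] bits→node d v ≡ p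
node→bits zero    []      _           = [] , refl
node→bits (suc d) []      _           = Vec.replicate (suc d * 2) false , refl
node→bits (suc d) (b ∷ p) (ℕ.s≤s p≤) with node→bits d p p≤
... | v , refl = true ∷ b ∷ v , refl

nodeCode : ∀ d → Code Node (λ p → length p ≤ d) (d * 2)
decode (nodeCode d) = bits→node d
encode (nodeCode d) = node→bits d

module Memory {A : Set} {P : A → Set} {w} (code : Code A P w) (n : ℕ) where

  cell : Fin n → Vec (Fin (n * w)) w
  cell j = Vec.tabulate (combine j)

  fetch : Vec Bool (n * w) → Fin n → A
  fetch y j = code .decode (Vec.map (lookup y) (cell j))

  store : ∀ (as : Fin n → A) → (∀ j → P (as j)) → ∃[ y ] ∀ j → fetch y j ≡ as j
  store as ok = y , λ j → trans (cong (code .decode) (word j)) (proj₂ (code .encode (as j) (ok j)))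
    where
    words : Fin n → Vec Bool w
    words j = proj₁ (code .encode (as j) (ok j))
    content : Fin (n * w) → Bool
    content q = lookup (words (proj₁ (remQuot w q))) (proj₂ (remQuot {n} w q))
    y = Vec.tabulate content
    word : ∀ j → Vec.map (lookup y) (cell j) ≡ words j
    word j = begin
      Vec.map (lookup y) (Vec.tabulate (combine j))     ≡⟨ Vec.tabulate-∘ (lookup y) (combine j) ⟨
      Vec.tabulate (λ a → lookup y (combine j a))       ≡⟨ Vec.tabulate-cong (λ a → trans (Vec.lookup∘tabulate content (combine j a))
                                                              (cong (λ (i , b) → lookup (words i) b) (Fin.remQuot-combine j a))) ⟩
      Vec.tabulate (lookup (words j))                   ≡⟨ Vec.tabulate∘lookup (words j) ⟩
      words j                                           ∎
      where open ≡-Reasoning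

  flags : (A → Bool) → Vec Bool (n * w) → Vec Bool n
  flags test y = Vec.tabulate (test ∘ fetch y)

  module _ {B : Set} where

    read : Fin n → (A → Tree (n * w) B) → Tree (n * w) B
    read j κ = readBits (cell j) (κ ∘ code .decode)

    run-read : ∀ j κ y → run (read j κ) y ≡ run (κ (fetch y j)) y
    run-read j κ y = run-readBits (cell j) (κ ∘ code .decode) y

    depth-read : ∀ {d} j {κ} → (∀ a → Depth≤ d (κ a)) → Depth≤ (w + d) (read j κ)
    depth-read j κ≤ = depth-readBits (cell j) (λ v → κ≤ (code .decode v))

  module _ {B : Set} (test : A → Bool) where

    readAny : ∀ {m} → Vec (Fin n) m → (Bool → Tree (n * w) B) → Tree (n * w) B
    readAny []       κ = κ false
    readAny (j ∷ js) κ = read j (λ a → if test a then κ true else readAny js κ)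

    run-readAny : ∀ {m} (js : Vec (Fin n) m) κ y → run (readAny js κ) y ≡ run (κ (Labelling.hit n (flags test y) js)) y
    run-readAny []       κ y = refl
    run-readAny (j ∷ js) κ y = trans (run-read j (λ a → if test a then κ true else readAny js κ) y) (step (Vec.lookup∘tabulate (test ∘ fetch y) j))
      where
      step : ∀ {b} → lookup (flags test y) j ≡ b →
        run (if b then κ true else readAny js κ) y ≡ run (κ (if lookup (flags test y) j then true else Labelling.hit n (flags test y) js)) y
      step {true}  eq rewrite eq = refl
      step {false} eq rewrite eq = run-readAny js κ y

    depth-readAny : ∀ {m d} (js : Vec (Fin n) m) {κ} → (∀ b → Depth≤ d (κ b)) → Depth≤ (m * w + d) (readAny js κ)
    depth-readAny []       κ≤ = κ≤ false
    depth-readAny {suc m} {d} (j ∷ js) {κ} κ≤ = subst (λ e → Depth≤ e (readAny (j ∷ js) κ)) (sym (ℕ.+-assoc w (m * w) d))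
      (depth-read j (λ a → branch (test a)))
      where
      branch : ∀ b → Depth≤ (m * w + d) (if b then κ true else readAny js κ)
      branch true  = Depth-mono (ℕ.m≤n+m d (m * w)) (κ≤ true)
      branch false = depth-readAny js κ≤

-- The two kinds of certificates

_!_ : {A : Set} → List A → ℕ → Maybe A
xs ! i = List.head (List.drop i xs)

∈⇒! : {A : Set} {xs : List A} {x : A} → x List.∈ xs → ∃[ i ] i ℕ.< length xs × xs ! i ≡ just x
∈⇒! (here refl) = 0 , ℕ.s≤s ℕ.z≤n , refl
∈⇒! (there x∈) with ∈⇒! x∈
... | i , i< , eq = suc i , ℕ.s≤s i< , eq

!⇒∈ : ∀ {A : Set} (xs : List A) i {x : A} → xs ! i ≡ just x → x List.∈ xs
!⇒∈ []       zero    ()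
!⇒∈ []       (suc i) ()
!⇒∈ (x ∷ xs) zero    refl = here refl
!⇒∈ (x ∷ xs) (suc i) eq   = there (!⇒∈ xs i eq)

all-true⁻ : {A : Set} {p : A → Bool} {xs : List A} → all p xs ≡ true → ∀ {x} → x List.∈ xs → p x ≡ true
all-true⁻ {p = p} {x ∷ xs} eq (here refl) with p x
... | true = refl
all-true⁻ {p = p} {y ∷ xs} eq (there x∈) with p y
... | true = all-true⁻ eq x∈

all-true⁺ : {A : Set} {p : A → Bool} (xs : List A) → (∀ {x} → x List.∈ xs → p x ≡ true) → all p xs ≡ true
all-true⁺ []       h = refl
all-true⁺ (x ∷ xs) h = cong₂ _∧_ (h (here refl)) (all-true⁺ xs (h ∘ there))

_≟ⁿ_ : (p q : Node) → Dec (p ≡ q)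
_≟ⁿ_ = List.≡-dec Bool._≟_

-- A word holds a flag and a column for one row of Y, the name of one listed node of the tree with
-- pointers to the words listing its two children, and a pointer to a flagged row.
Entry : ℕ → Set
Entry n = Bool × Fin n × Node × Fin n × Fin n × Fin n

module _ {n : ℕ} where

  flag : Entry n → Bool
  flag (b , _) = b

  column : Entry n → Fin n
  column (_ , c , _) = c

  name : Entry n → Node
  name (_ , _ , p , _) = p

  child : Bool → Entry n → Fin n
  child false (_ , _ , _ , j , _) = j
  child true  (_ , _ , _ , _ , j , _) = j

  witness : Entry n → Fin n
  witness (_ , _ , _ , _ , _ , j) = j

Valid : ∀ {n} → ℕ → Entry n → Set
Valid D (_ , _ , p , _) = ⊤ × ⊤ × length p ≤ D × ⊤ × ⊤ × ⊤

-- The predicates as conjunctions of local checks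

module Game {n D w N : ℕ} (code : Code (Entry n) (Valid D) w)
  (W : Node → Fin N) (Y : Fin n → Fin n → Fin N)
  (label : Node → Vec (Fin n) 4) (origin : Fin n) where

  open Memory code n public
  open Labelling n using (hit)

  Check : Set
  Check = Tree (n * w) (Outcome N)

  pathRows : Node → List (Fin n)
  pathRows []      = toList (label [])
  pathRows (s ∷ p) = toList (label (s ∷ p)) ++ pathRows p

  length-pathRows : ∀ p → length (pathRows p) ≡ suc (length p) * 4
  length-pathRows []      = Vec.length-toList (label [])
  length-pathRows (s ∷ p) = trans (List.length-++ (toList (label (s ∷ p))))
    (cong₂ _+_ (Vec.length-toList (label (s ∷ p))) (length-pathRows p))

  rowOutcome : Fin n → Entry n → Outcome N
  rowOutcome j e = if flag e then literal (Y j (column e)) true else verdict true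

  -- This test forces at least one flagged row, and thereby a 1 in `Y`, so that the zero input has
  -- no 0-description.
  witnessNext : Entry n → Check
  witnessNext e = read (witness e) (leaf ∘ verdict ∘ flag)

  rowCheck witnessCheck rootCheck : Fin n → Check
  rowCheck j = read j (leaf ∘ rowOutcome j)
  witnessCheck j = read j witnessNext

  namedOutcome : Node → Entry n → Outcome N
  namedOutcome p e = verdict (does (name e ≟ⁿ p))

  coveredCheck : Node → Fin n → Check
  coveredCheck p j = readAny flag (label p) (λ b → if b then leaf (verdict true) else read j (leaf ∘ namedOutcome p))

  -- The argument is ignored to give all five kinds of checks the same type. The root test is thus
  -- repeated `n` times, within a total of `5 * n`.
  rootCheck _ = coveredCheck [] origin

  childNext : Bool → Entry n → Check
  childNext s e =
    if does (D ℕ.≤? length (name e)) then leaf (literal (W (name e)) false) else coveredCheck (s ∷ name e) (child s e)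

  childCheck : Bool → Fin n → Check
  childCheck s j = read j (childNext s)

  leafOutcome : Entry n → Outcome N
  leafOutcome e = if does (length (name e) ℕ.≟ D) then literal (W (name e)) true else verdict false

  -- Positions beyond the end of the path impose nothing. For a node of depth `D` the path has
  -- exactly `suc D * 4` row entries, so `checks true` covers all of them.
  zeroOutcome : Fin n → Maybe (Fin n) → Outcome N
  zeroOutcome c nothing  = verdict true
  zeroOutcome c (just r) = literal (Y r c) false

  zeroNext : ℕ → Fin n → Entry n → Check
  zeroNext q c e = leaf (zeroOutcome c (pathRows (name e) ! q))

  zeroCheck : ℕ → Fin n → Check
  zeroCheck q c = read origin (zeroNext q c)

  checkKinds : List (Fin n → Check)
  checkKinds = rootCheck ∷ rowCheck ∷ witnessCheck ∷ childCheck false ∷ childCheck true ∷ []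

  checks : Bool → List Check
  checks false = cartesianProductWith (λ κ j → κ j) checkKinds (allFin n)
  checks true  = read origin (leaf ∘ leafOutcome) ∷ cartesianProductWith zeroCheck (upTo (suc D * 4)) (allFin n)

  φ : Bool → Input N → Vec Bool (n * w) → Bool
  φ b = accepts (checks b)

  length-checks-false : length (checks false) ≡ 5 * n
  length-checks-false = trans (length-product (λ κ j → κ j) checkKinds (allFin n)) (cong (5 *_) (List.length-tabulate {n = n} (λ i → i)))

  length-checks-true : length (checks true) ≡ suc (suc D * 4 * n)
  length-checks-true = cong suc (trans (length-product zeroCheck (upTo (suc D * 4)) (allFin n))
    (cong₂ _*_ (List.length-upTo (suc D * 4)) (List.length-tabulate {n = n} (λ i → i))))

  -- The deepest check is `childCheck`: it reads a word, then the words of the four rows in a label,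
  -- then the word of the child.
  depth : ℕ
  depth = w + (4 * w + (w + 0))

  readLeaf-depth : ∀ {d} j (o : Entry n → Outcome N) → Depth≤ (w + d) (read j (leaf ∘ o))
  readLeaf-depth j o = depth-read j {leaf ∘ o} (λ _ → leaf≤)

  coveredCheck-depth : ∀ p j → Depth≤ (4 * w + (w + 0)) (coveredCheck p j)
  coveredCheck-depth p j = depth-readAny flag (label p) λ { true → leaf≤ ; false → readLeaf-depth j (namedOutcome p) }

  childCheck-depth : ∀ s j → Depth≤ depth (childCheck s j)
  childCheck-depth s j = depth-read j λ e → branch e (does (D ℕ.≤? length (name e)))
    where
    branch : ∀ e b → Depth≤ (4 * w + (w + 0)) (if b then leaf (literal (W (name e)) false) else coveredCheck (s ∷ name e) (child s e))
    branch e true  = leaf≤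
    branch e false = coveredCheck-depth (s ∷ name e) (child s e)

  checks-depth : ∀ b → All (Depth≤ depth) (checks b)
  checks-depth true  = readLeaf-depth origin leafOutcome ∷ All.tabulate zero-depth
    where
    zero-depth : ∀ {t} → t List.∈ cartesianProductWith zeroCheck (upTo (suc D * 4)) (allFin n) → Depth≤ depth t
    zero-depth t∈ with ∈-cartesianProductWith⁻ zeroCheck (upTo (suc D * 4)) (allFin n) t∈
    ... | q , c , _ , _ , refl = readLeaf-depth origin (λ e → zeroOutcome c (pathRows (name e) ! q))
  checks-depth false = All.tabulate kind-depth
    where
    kind-depth : ∀ {t} → t List.∈ checks false → Depth≤ depth t
    kind-depth t∈ with ∈-cartesianProductWith⁻ (λ κ j → κ j) checkKinds (allFin n) t∈
    ... | _ , j , here refl , _ , refl = Depth-mono (ℕ.m≤n+m _ w) (coveredCheck-depth [] origin)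
    ... | _ , j , there (here refl) , _ , refl = readLeaf-depth j (rowOutcome j)
    ... | _ , j , there (there (here refl)) , _ , refl =
      depth-read j (λ e → Depth-mono (ℕ.m≤n+m (w + 0) (4 * w)) (readLeaf-depth (witness e) (verdict ∘ flag)))
    ... | _ , j , there (there (there (here refl))) , _ , refl = childCheck-depth false j
    ... | _ , j , there (there (there (there (here refl)))) , _ , refl = childCheck-depth true j

  -- The conditions expressed by the checks

  Covered : Vec Bool (n * w) → Node → Fin n → Set
  Covered y p j = hit (flags flag y) (label p) ≡ true ⊎ name (fetch y j) ≡ p

  record Zero (x : Input N) (y : Vec Bool (n * w)) : Set where
    field
      rows     : ∀ j → flag (fetch y j) ≡ true → lookup x (Y j (column (fetch y j))) ≡ true
      flagged  : ∀ j → flag (fetch y (witness (fetch y j))) ≡ true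
      root     : Covered y [] origin
      children : ∀ s j → length (name (fetch y j)) ℕ.< D → Covered y (s ∷ name (fetch y j)) (child s (fetch y j))
      leaves   : ∀ j → D ≤ length (name (fetch y j)) → lookup x (W (name (fetch y j))) ≡ false

  record One (x : Input N) (y : Vec Bool (n * w)) : Set where
    p = name (fetch y origin)
    field
      isLeaf : length p ≡ D
      atLeaf : lookup x (W p) ≡ true
      zeros  : ∀ {r} → r List.∈ pathRows p → ∀ c → lookup x (Y r c) ≡ false

  module _ (x : Input N) (y : Vec Bool (n * w)) where

    private
      e : Fin n → Entry n
      e = fetch y

    accepted : ∀ ts → accepts ts x y ≡ true → ∀ {t} → t List.∈ ts → check t x y ≡ true
    accepted ts = all-true⁻ {p = λ t → check t x y} {ts}

    check-read : ∀ j κ → check (read j κ) x y ≡ check (κ (e j)) x y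
    check-read j κ = cong (sat x) (run-read j κ y)

    check-covered : ∀ p j → check (coveredCheck p j) x y ≡
      (if hit (flags flag y) (label p) then true else does (name (e j) ≟ⁿ p))
    check-covered p j = trans (cong (sat x) (run-readAny flag (label p) κ y)) (branch (hit (flags flag y) (label p)))
      where
      κ : Bool → Check
      κ b = if b then leaf (verdict true) else read j (leaf ∘ namedOutcome p)
      branch : ∀ b → check (κ b) x y ≡ (if b then true else does (name (e j) ≟ⁿ p))
      branch true  = refl
      branch false = check-read j (leaf ∘ namedOutcome p)

    covered⁻ : ∀ p j → check (coveredCheck p j) x y ≡ true → Covered y p j
    covered⁻ p j eq = cases (trans (sym (check-covered p j)) eq)
      where
      cases : (if hit (flags flag y) (label p) then true else does (name (e j) ≟ⁿ p)) ≡ true → Covered y p j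
      cases eq with hit (flags flag y) (label p) | name (e j) ≟ⁿ p
      ... | true  | _        = inj₁ refl
      ... | false | yes refl = inj₂ refl

    covered⁺ : ∀ p j → Covered y p j → check (coveredCheck p j) x y ≡ true
    covered⁺ p j cov = trans (check-covered p j) (cases cov)
      where
      cases : Covered y p j → (if hit (flags flag y) (label p) then true else does (name (e j) ≟ⁿ p)) ≡ true
      cases (inj₁ h)  rewrite h = refl
      cases (inj₂ eq) with hit (flags flag y) (label p)
      ... | true  = refl
      ... | false = dec-true (name (e j) ≟ⁿ p) eq

    φ-false⁻ : φ false x y ≡ true → Zero x y
    φ-false⁻ acc = record
      { rows     = λ j f → row j f (trans (sym (check-read j (leaf ∘ rowOutcome j))) (passes (there (here refl)) j))
      ; flagged  = λ j → trans (sym (trans (check-read j witnessNext) (check-read (witness (e j)) (leaf ∘ verdict ∘ flag)))) (passes (there (there (here refl))) j)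
      ; root     = covered⁻ [] origin (passes (here refl) origin)
      ; children = λ s j short → covered⁻ (s ∷ name (e j)) (child s (e j)) (inner s j short (trans (sym (check-read j (childNext s))) (passes (kind s) j)))
      ; leaves   = λ j long → not-true (outer j long (trans (sym (check-read j (childNext false))) (passes (kind false) j)))
      }
      where
      passes : ∀ {κ : Fin n → Check} → κ List.∈ checkKinds → ∀ j → check (κ j) x y ≡ true
      passes κ∈ j = accepted (checks false) acc (∈-cartesianProductWith⁺ (λ κ j → κ j) κ∈ (∈-allFin j))
      kind : ∀ s → childCheck s List.∈ checkKinds
      kind false = there (there (there (here refl)))
      kind true  = there (there (there (there (here refl))))
      row : ∀ j → flag (e j) ≡ true → sat x (rowOutcome j (e j)) ≡ true → lookup x (Y j (column (e j))) ≡ true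
      row j f eq rewrite f = eq
      inner : ∀ s j → length (name (e j)) ℕ.< D →
        check (childNext s (e j)) x y ≡ true →
        check (coveredCheck (s ∷ name (e j)) (child s (e j))) x y ≡ true
      inner s j short eq rewrite dec-false (D ℕ.≤? length (name (e j))) (ℕ.<⇒≱ short) = eq
      outer : ∀ j → D ≤ length (name (e j)) →
        check (childNext false (e j)) x y ≡ true →
        not (lookup x (W (name (e j)))) ≡ true
      outer j long eq rewrite dec-true (D ℕ.≤? length (name (e j))) long = eq
      not-true : ∀ {b} → not b ≡ true → b ≡ false
      not-true {false} _ = refl

    φ-false⁺ : Zero x y → φ false x y ≡ true
    φ-false⁺ z = all-true⁺ (checks false) pass
      where
      open Zero z
      row : ∀ j → sat x (rowOutcome j (e j)) ≡ true
      row j with flag (e j) in f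
      ... | true  = rows j f
      ... | false = refl
      down : ∀ s j → check (childCheck s j) x y ≡ true
      down s j = trans (check-read j (childNext s)) (branch (D ℕ.≤? length (name (e j))))
        where
        branch : (d : Dec (D ≤ length (name (e j)))) →
          check (if does d then leaf (literal (W (name (e j))) false) else coveredCheck (s ∷ name (e j)) (child s (e j))) x y ≡ true
        branch (yes long)  = cong not (leaves j long)
        branch (no  short) = covered⁺ (s ∷ name (e j)) (child s (e j)) (children s j (ℕ.≰⇒> short))
      pass : ∀ {t} → t List.∈ checks false → check t x y ≡ true
      pass t∈ with ∈-cartesianProductWith⁻ (λ κ j → κ j) checkKinds (allFin n) t∈
      ... | _ , j , here refl , _ , refl = covered⁺ [] origin root
      ... | _ , j , there (here refl) , _ , refl = trans (check-read j (leaf ∘ rowOutcome j)) (row j)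
      ... | _ , j , there (there (here refl)) , _ , refl =
        trans (check-read j witnessNext) (trans (check-read (witness (e j)) (leaf ∘ verdict ∘ flag)) (flagged j))
      ... | _ , j , there (there (there (here refl))) , _ , refl = down false j
      ... | _ , j , there (there (there (there (here refl)))) , _ , refl = down true j

    φ-true⁻ : φ true x y ≡ true → One x y
    φ-true⁻ acc = record { isLeaf = proj₁ first ; atLeaf = proj₂ first ; zeros = zeros }
      where
      p = name (e origin)
      cases : (d : Dec (length p ≡ D)) → sat x (if does d then literal (W p) true else verdict false) ≡ true →
        length p ≡ D × lookup x (W p) ≡ true
      cases (yes len) eq = len , eq
      first : length p ≡ D × lookup x (W p) ≡ true
      first = cases (length p ℕ.≟ D) (trans (sym (check-read origin (leaf ∘ leafOutcome))) (accepted (checks true) acc (here refl)))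
      zero-at : ∀ q c → q ℕ.< suc D * 4 → sat x (zeroOutcome c (pathRows p ! q)) ≡ true
      zero-at q c q< = trans (sym (check-read origin (zeroNext q c)))
        (accepted (checks true) acc (there (∈-cartesianProductWith⁺ zeroCheck (∈-upTo⁺ q<) (∈-allFin c))))
      zeros : ∀ {r} → r List.∈ pathRows p → ∀ c → lookup x (Y r c) ≡ false
      zeros {r} r∈ c with ∈⇒! r∈
      ... | q , q< , eq = not-true (subst (λ m → sat x (zeroOutcome c m) ≡ true) eq
              (zero-at q c (subst (q ℕ.<_) (trans (length-pathRows p) (cong (λ d → suc d * 4) (proj₁ first))) q<)))
        where
        not-true : ∀ {b} → not b ≡ true → b ≡ false
        not-true {false} _ = refl

    φ-true⁺ : One x y → φ true x y ≡ true
    φ-true⁺ o = all-true⁺ (checks true) pass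
      where
      open One o
      leaf-passes : (d : Dec (length p ≡ D)) → sat x (if does d then literal (W p) true else verdict false) ≡ true
      leaf-passes (yes _)    = atLeaf
      leaf-passes (no ¬leaf) = contradiction isLeaf ¬leaf
      zero-passes : ∀ q c m → pathRows p ! q ≡ m → sat x (zeroOutcome c m) ≡ true
      zero-passes q c nothing  eq = refl
      zero-passes q c (just r) eq = cong not (zeros (!⇒∈ (pathRows p) q eq) c)
      pass : ∀ {t} → t List.∈ checks true → check t x y ≡ true
      pass (here refl) = trans (check-read origin (leaf ∘ leafOutcome)) (leaf-passes (length p ℕ.≟ D))
      pass (there t∈) with ∈-cartesianProductWith⁻ zeroCheck (upTo (suc D * 4)) (allFin n) t∈
      ... | q , c , _ , _ , refl = trans (check-read origin (zeroNext q c)) (zero-passes q c (pathRows p ! q) refl)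

  lookup-flags : ∀ y r → lookup (flags flag y) r ≡ flag (fetch y r)
  lookup-flags y r = Vec.lookup∘tabulate (flag ∘ fetch y) r

  unhit : ∀ {m} R (l : Vec (Fin n) m) → (∀ {r} → r List.∈ toList l → lookup R r ≡ false) → hit R l ≡ false
  unhit R []      off = refl
  unhit R (r ∷ l) off rewrite off (here refl) = unhit R l (off ∘ there)

  -- The children condition leads from the root of the tree down to the leaf marked by the 1-description.
  disjoint : ∀ {x y y′} → One x y → Zero x y′ → Empty.⊥
  disjoint {x} {y} {y′} one zer = conflict (walk p (ℕ.≤-reflexive isLeaf) unflagged)
    where
    open One one
    open Zero zer
    false≢true : ∀ {b} → b ≡ false → b ≡ true → Empty.⊥
    false≢true refl ()
    unflagged : ∀ {r} → r List.∈ pathRows p → lookup (flags flag y′) r ≡ false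
    unflagged {r} r∈ with flag (fetch y′ r) in f
    ... | false = trans (lookup-flags y′ r) f
    ... | true  = ⊥-elim (false≢true (zeros r∈ (column (fetch y′ r))) (rows r f))
    step : ∀ {q j} → (∀ {r} → r List.∈ toList (label q) → lookup (flags flag y′) r ≡ false) →
      Covered y′ q j → ∃[ j ] name (fetch y′ j) ≡ q
    step {q} off (inj₁ h)  = ⊥-elim (false≢true (unhit (flags flag y′) (label q) off) h)
    step {j = j} off (inj₂ eq) = j , eq
    walk : ∀ q → length q ≤ D → (∀ {r} → r List.∈ pathRows q → lookup (flags flag y′) r ≡ false) →
      ∃[ j ] name (fetch y′ j) ≡ q
    walk []      _  off = step off root
    walk (s ∷ q) q< off with walk q (ℕ.<⇒≤ q<) (λ r∈ → off (∈-++⁺ʳ (toList (label (s ∷ q))) r∈))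
    ... | j , refl = step (λ r∈ → off (∈-++⁺ˡ r∈)) (children s j q<)
    conflict : ∃[ j ] name (fetch y′ j) ≡ p → Empty.⊥
    conflict (j , eq) = false≢true
      (subst (λ q → lookup x (W q) ≡ false) eq (leaves j (subst (λ q → D ≤ length q) (sym eq) (ℕ.≤-reflexive (sym isLeaf)))))
      atLeaf

  -- The checks for a 1-description read only the word at `origin`, so one and the same entry can be
  -- stored in every word.
  one-exists : ∀ x p → length p ≡ D → lookup x (W p) ≡ true →
    (∀ {r} → r List.∈ pathRows p → ∀ c → lookup x (Y r c) ≡ false) → ∃[ y ] φ true x y ≡ true
  one-exists x p len at zeros with store (λ _ → false , origin , p , origin , origin , origin)
                                         (λ _ → tt , tt , ℕ.≤-reflexive len , tt , tt , tt)
  ... | y , stored = y , φ-true⁺ x y (record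
    { isLeaf = subst (λ q → length q ≡ D) (sym named) len
    ; atLeaf = subst (λ q → lookup x (W q) ≡ true) (sym named) at
    ; zeros  = subst (λ q → ∀ {r} → r List.∈ pathRows q → ∀ c → lookup x (Y r c) ≡ false) (sym named) zeros })
    where
    named : name (fetch y origin) ≡ p
    named = cong name (stored origin)

  module _ (R : Vec Bool n) (S : List Node) (S≤n : length S ≤ n) (origin≡0 : Fin.toℕ origin ≡ 0)
    (short : ∀ {q} → q List.∈ S → length q ≤ D)
    (top : hit R (label []) ≡ true ⊎ S ! 0 ≡ just [])
    (closed : ∀ {q} s → q List.∈ S → length q ℕ.< D → hit R (label (s ∷ q)) ≡ true ⊎ (s ∷ q) List.∈ S) where

    private
      -- Unused words are given the name of a leaf, about which nothing but W = 0 is claimed.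
      spare : Node
      spare = List.replicate D true

      names : Fin n → Node
      names j = fromMaybe spare (S ! Fin.toℕ j)

      names-cases : ∀ j → names j List.∈ S ⊎ names j ≡ spare
      names-cases j with S ! Fin.toℕ j in eq
      ... | just q  = inj₁ (!⇒∈ S (Fin.toℕ j) eq)
      ... | nothing = inj₂ refl

      pointer-to : ∀ {q} → Dec (q List.∈ S) → Fin n
      pointer-to (yes q∈) = Fin.fromℕ< (ℕ.<-≤-trans (proj₁ (proj₂ (∈⇒! q∈))) S≤n)
      pointer-to (no _)   = origin

      pointer : Node → Fin n
      pointer q = pointer-to (Any.any? (q ≟ⁿ_) S)

      names-pointer-to : ∀ {q} (d : Dec (q List.∈ S)) → q List.∈ S → names (pointer-to d) ≡ q
      names-pointer-to (yes q∈) _ =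
        trans (cong (λ i → fromMaybe spare (S ! i)) (Fin.toℕ-fromℕ< (ℕ.<-≤-trans (proj₁ (proj₂ (∈⇒! q∈))) S≤n))) (cong (fromMaybe spare) (proj₂ (proj₂ (∈⇒! q∈))))
      names-pointer-to (no q∉) q∈ = contradiction q∈ q∉

      names-short : ∀ j → length (names j) ≤ D
      names-short j with names-cases j
      ... | inj₁ j∈ = short j∈
      ... | inj₂ eq = ℕ.≤-reflexive (trans (cong length eq) (List.length-replicate D))

    -- Word `j` serves two independent purposes, row `j` of `Y` and the `j`-th listed node;
    -- `length S ≤ n` makes the list fit. All witnesses point to the one flagged row `r₁`.
    zero-exists : ∀ x (col : Fin n → Fin n) (r₁ : Fin n) → lookup R r₁ ≡ true →
      (∀ r → lookup R r ≡ true → lookup x (Y r (col r)) ≡ true) → (∀ p → lookup x (W p) ≡ false) →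
      ∃[ y ] φ false x y ≡ true
    zero-exists x col r₁ on rows-on W-off = y , φ-false⁺ x y (record
        { rows     = rows
        ; flagged  = λ j → trans (cong (λ e → flag (fetch y (witness e))) (stored j)) (trans (cong flag (stored r₁)) on)
        ; root     = root top
        ; children = children
        ; leaves   = λ j _ → W-off (name (fetch y j)) })
      where
      es : Fin n → Entry n
      es j = lookup R j , col j , names j , pointer (false ∷ names j) , pointer (true ∷ names j) , r₁
      memory = store es (λ j → tt , tt , names-short j , tt , tt , tt)
      y = proj₁ memory
      stored : ∀ j → fetch y j ≡ es j
      stored = proj₂ memory
      flags≡R : flags flag y ≡ R
      flags≡R = trans (Vec.tabulate-cong (λ j → cong flag (stored j))) (Vec.tabulate∘lookup R)
      rows : ∀ j → flag (fetch y j) ≡ true → lookup x (Y j (column (fetch y j))) ≡ true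
      rows j f = subst (λ e → lookup x (Y j (column e)) ≡ true) (sym (stored j))
        (rows-on j (subst (λ e → flag e ≡ true) (stored j) f))
      root : hit R (label []) ≡ true ⊎ S ! 0 ≡ just [] → Covered y [] origin
      root (inj₁ h)  = inj₁ (subst (λ R → hit R (label []) ≡ true) (sym flags≡R) h)
      root (inj₂ eq) = inj₂ (trans (cong name (stored origin))
        (cong (fromMaybe spare) (trans (cong (S !_) origin≡0) eq)))
      child-pointer : ∀ s j → child s (es j) ≡ pointer (s ∷ names j)
      child-pointer false j = refl
      child-pointer true  j = refl
      covered : ∀ s j → hit R (label (s ∷ names j)) ≡ true ⊎ (s ∷ names j) List.∈ S → Covered y (s ∷ names j) (pointer (s ∷ names j))
      covered s j (inj₁ h)  = inj₁ (subst (λ R → hit R (label (s ∷ names j)) ≡ true) (sym flags≡R) h)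
      covered s j (inj₂ q∈) = inj₂ (trans (cong name (stored (pointer (s ∷ names j)))) (names-pointer-to (Any.any? ((s ∷ names j) ≟ⁿ_) S) q∈))
      children : ∀ s j → length (name (fetch y j)) ℕ.< D → Covered y (s ∷ name (fetch y j)) (child s (fetch y j))
      children s j = subst (λ e → length (name e) ℕ.< D → Covered y (s ∷ name e) (child s e)) (sym (stored j))
        (λ short → subst (Covered y (s ∷ names j)) (sym (child-pointer s j)) (covered s j (cases short (names-cases j))))
        where
        cases : length (names j) ℕ.< D → names j List.∈ S ⊎ names j ≡ spare →
          hit R (label (s ∷ names j)) ≡ true ⊎ (s ∷ names j) List.∈ S
        cases short (inj₁ j∈) = closed s j∈ short
        cases short (inj₂ eq) = contradiction (trans (cong length eq) (List.length-replicate D)) (ℕ.<⇒≢ short)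

-- Lower bounds

unique-lookup : ∀ {A : Set} {xs : List A} → Unique xs → ∀ i j → List.lookup xs i ≡ List.lookup xs j → i ≡ j
unique-lookup {xs = x ∷ xs} (x∉ ∷ u) zero    zero    eq = refl
unique-lookup {xs = x ∷ xs} (x∉ ∷ u) zero    (suc j) eq = contradiction eq (All.lookup x∉ (∈-lookup j))
unique-lookup {xs = x ∷ xs} (x∉ ∷ u) (suc i) zero    eq = contradiction (sym eq) (All.lookup x∉ (∈-lookup i))
unique-lookup {xs = x ∷ xs} (x∉ ∷ u) (suc i) (suc j) eq = cong suc (unique-lookup u i j eq)

head∈toList : ∀ {A : Set} {m} (v : Vec A (suc m)) → Vec.head v List.∈ toList v
head∈toList (x ∷ v) = here refl

module Bounds {n D w N : ℕ} (code : Code (Entry n) (Valid D) w)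
  (W : Node → Fin N) (Y : Fin n → Fin n → Fin N) (inY : Fin N → Bool)
  (W-injective : ∀ {p q} → length p ≡ D → length q ≡ D → W p ≡ W q → p ≡ q)
  (Y-injective : ∀ {r c r′ c′} → Y r c ≡ Y r′ c′ → r ≡ r′ × c ≡ c′)
  (inY-W : ∀ p → inY (W p) ≡ false) (inY-Y : ∀ r c → inY (Y r c) ≡ true)
  (origin : Fin n) (origin≡0 : Fin.toℕ origin ≡ 0)
  (L : Labelling.Labels n)
  (few-survivors : ∀ R → 2 * length (Labelling.unflagged n R) ≤ n → Labelling.survivors# n R L (suc D) ≤ n) where

  open Labelling n using (hit; unflagged; survivors; length-survivors; length-survivor; child-survives; root-listed-first)

  label : Node → Vec (Fin n) 4
  label = Labelling.label n L

  open Game code W Y label origin public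

  abstract
    never-both : ∀ {x y y′} → φ true x y ≡ true → φ false x y′ ≡ true → Empty.⊥
    never-both {x} {y} {y′} one zer = disjoint (φ-true⁻ x y one) (φ-false⁻ x y′ zer)

  open Described φ never-both public

  W≢Y : ∀ {p r c} → W p ≢ Y r c
  W≢Y {p} {r} {c} eq with trans (sym (inY-W p)) (trans (cong inY eq) (inY-Y r c))
  ... | ()

  n>0 : 0 ℕ.< n
  n>0 = ℕ.≤-<-trans ℕ.z≤n (Fin.toℕ<n origin)

  z : Input N
  z = Vec.replicate N false

  z-false : ∀ i → lookup z i ≡ false
  z-false i = Vec.lookup-replicate i false

  update-false : ∀ {i j} → i ≢ j → lookup (z [ j ]≔ true) i ≡ false
  update-false {i} {j} i≢j = trans (Vec.lookup∘update′ i≢j z true) (z-false i)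

  -- Descriptions of both kinds demand a 1 somewhere: in the cell of the leaf, or in the flagged row
  -- found through a witness.
  f-z : f z ≡ nothing
  f-z = f-nothing z none
    where
    clash : ∀ {i} → lookup z i ≡ true → Empty.⊥
    clash {i} eq with trans (sym (z-false i)) eq
    ... | ()
    none : ∀ b y → ¬ (φ b z y ≡ true)
    none true  y eq = clash (One.atLeaf (φ-true⁻ z y eq))
    none false y eq = clash (Zero.rows zer _ (Zero.flagged zer origin))
      where zer = φ-false⁻ z y eq

  update-consistent : ∀ {ρ : PartialAssignment N} {x i b} → Consistent ρ x → ¬ Fixes ρ i → Consistent ρ (x [ i ]≔ b)
  update-consistent {ρ} {x} {i} {b} ρx free = consistent-agree ρx λ j fixed →
    sym (Vec.lookup∘update′ (λ { refl → free fixed }) x b)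

  mark-leaf : ∀ p → length p ≡ D → f (z [ W p ]≔ true) ≡ just true
  mark-leaf p len = f-described true (z [ W p ]≔ true) (proj₁ described) (proj₂ described)
    where
    described = one-exists (z [ W p ]≔ true) p len (Vec.lookup∘update (W p) z true) (λ _ c → update-false (λ eq → W≢Y (sym eq)))

  -- If the cell of a leaf were left free, it could be raised to 1 while `Y` stays zero, and
  -- `mark-leaf` would give a completion with value 1.
  C-not1-≥ : ∀ {m} (leaves : Fin m → Node) → (∀ a → length (leaves a) ≡ D) →
    Injective _≡_ _≡_ (W ∘ leaves) → m ≤ N → m ≤ C-not1 f z
  C-not1-≥ leaves len inj m≤N = C-at-≥ _ f m≤N λ ρ (ρz , ok) → size-≥ ρ (W ∘ leaves) inj (λ a → fixed ρ ρz ok a (fixes? ρ (W (leaves a))))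
    where
    fixed : ∀ ρ → Consistent ρ z → (∀ x → Consistent ρ x → Any (f x ≡_) (just false ∷ nothing ∷ [])) →
      ∀ a → Dec (Fixes ρ (W (leaves a))) → Fixes ρ (W (leaves a))
    fixed ρ ρz ok a (yes fix) = fix
    fixed ρ ρz ok a (no free) = ⊥-elim (absurd (ok (z [ W (leaves a) ]≔ true) (update-consistent ρz free)) (mark-leaf (leaves a) (len a)))
      where
      absurd : ∀ {v : Value} → Any (v ≡_) (just false ∷ nothing ∷ []) → v ≡ just true → Empty.⊥
      absurd (here refl) ()
      absurd (there (here refl)) ()

  top∈pathRows : ∀ p → Vec.head (label p) List.∈ pathRows p
  top∈pathRows []      = head∈toList (label [])
  top∈pathRows (s ∷ p) = ∈-++⁺ˡ (head∈toList (label (s ∷ p)))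

  -- In the input with a single 1, at the cell of the leaf `p`, every 1-description must name `p`. A
  -- further 1 in row `r`, which occurs on the path to `p`, rules this out and leaves `W` unchanged.
  -- So a 1-certificate for this input fixes all `n` cells of that row.
  C-≥ : n ≤ N → n ≤ C f
  C-≥ n≤N = ℕ.≤-trans (ℕ.≤-trans
      (C-at-≥ (just true ∷ []) f n≤N (λ ρ (ρx , ok) → size-≥ ρ (Y r) (λ eq → proj₂ (Y-injective eq)) (λ c → fixed ρ ρx ok c (fixes? ρ (Y r c)))))
      (C-max-≥ (just true ∷ []) f (here (mark-leaf p len))))
    (ℕ.m≤n⊔m (C-max (just false ∷ []) f) (C-max (just true ∷ []) f))
    where
    p = List.replicate D true
    len = List.length-replicate D
    r = Vec.head (label p)
    x = z [ W p ]≔ true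
    true≢false : ∀ {b} → b ≡ true → b ≡ false → Empty.⊥
    true≢false refl ()
    contra : ∀ {y} c → One (x [ Y r c ]≔ true) y → Dec (W (name (fetch y origin)) ≡ W p) → Empty.⊥
    contra c one (yes same) = true≢false (Vec.lookup∘update (Y r c) x true)
      (One.zeros one (subst (λ q → r List.∈ pathRows q) (sym (W-injective (One.isLeaf one) len same)) (top∈pathRows p)) c)
    contra c one (no other) = true≢false (One.atLeaf one) (trans (Vec.lookup∘update′ W≢Y x true) (update-false other))
    changes : ∀ c → f (x [ Y r c ]≔ true) ≡ just true → Empty.⊥
    changes c eq = contra c (φ-true⁻ (x [ Y r c ]≔ true) (proj₁ described) (proj₂ described)) (W _ Fin.≟ W p)
      where described = f-just true (x [ Y r c ]≔ true) eq
    head-eq : ∀ {v : Value} → Any (v ≡_) (just true ∷ []) → v ≡ just true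
    head-eq (here eq) = eq
    fixed : ∀ ρ → Consistent ρ x → (∀ x′ → Consistent ρ x′ → Any (f x′ ≡_) (just true ∷ [])) →
      ∀ c → Dec (Fixes ρ (Y r c)) → Fixes ρ (Y r c)
    fixed ρ ρx ok c (yes fix) = fix
    fixed ρ ρx ok c (no free) = ⊥-elim (changes c (head-eq (ok (x [ Y r c ]≔ true) (update-consistent ρx free))))

  module _ (ρ : PartialAssignment N) (ρz : Consistent ρ z) where

    private
      free? : Decidable (λ r → ∃[ c ] ¬ Fixes ρ (Y r c))
      free? r = Fin.any? (λ c → ¬? (fixes? ρ (Y r c)))

      -- The flagged rows are those in which `ρ` leaves a cell free, so that a 1 can be placed
      -- there. The unflagged rows are fixed entirely and contribute `n` cells each to the size of
      -- `ρ`.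
      R : Vec Bool n
      R = Vec.tabulate (does ∘ free?)

      R-lookup : ∀ r → lookup R r ≡ does (free? r)
      R-lookup = Vec.lookup∘tabulate (does ∘ free?)

      unflagged-fixed : ∀ {r} → r List.∈ unflagged R → ∀ c → Fixes ρ (Y r c)
      unflagged-fixed {r} r∈ c = cases (free? r) (trans (sym (R-lookup r)) (proj₂ (∈-filter⁻ (λ r → lookup R r Bool.≟ false) {xs = allFin n} r∈)))
        where
        decide : Dec (Fixes ρ (Y r c)) → ¬ (∃[ c ] ¬ Fixes ρ (Y r c)) → Fixes ρ (Y r c)
        decide (yes fix) _    = fix
        decide (no free) none = contradiction (c , free) none
        cases : (d : Dec (∃[ c ] ¬ Fixes ρ (Y r c))) → does d ≡ false → Fixes ρ (Y r c)
        cases (no none) _ = decide (fixes? ρ (Y r c)) none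

      fixed-rows : length (unflagged R) * n ≤ size ρ
      fixed-rows = size-≥ ρ cell-of cell-of-injective (λ q → unflagged-fixed (∈-lookup (proj₁ (remQuot n q))) (proj₂ (remQuot {length us} n q)))
        where
        us = unflagged R
        cell-of : Fin (length us * n) → Fin N
        cell-of q = Y (List.lookup us (proj₁ (remQuot n q))) (proj₂ (remQuot {length us} n q))
        cell-of-injective : Injective _≡_ _≡_ cell-of
        cell-of-injective {q} {q′} eq with Y-injective eq
        ... | r≡ , c≡ = trans (sym (Fin.combine-remQuot {length us} n q)) (trans
          (cong₂ combine (unique-lookup (Unique.filter⁺ (λ r → lookup R r Bool.≟ false) (Unique.allFin⁺ n)) _ _ r≡) c≡)
          (Fin.combine-remQuot {length us} n q′))

      -- The completion of `ρ` with 1 in all free cells of `Y` and 0 everywhere else; in particular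
      -- `W` stays zero.
      filled : Input N
      filled = Vec.tabulate (λ i → if does (fixes? ρ i) then false else inY i)

      filled-lookup : ∀ i → lookup filled i ≡ (if does (fixes? ρ i) then false else inY i)
      filled-lookup = Vec.lookup∘tabulate _

      filled-fixed : ∀ i → Fixes ρ i → lookup z i ≡ lookup filled i
      filled-fixed i fix = trans (z-false i) (sym (trans (filled-lookup i)
        (cong (λ b → if b then false else inY i) (dec-true (fixes? ρ i) fix))))

      filled-free : ∀ i → ¬ Fixes ρ i → lookup filled i ≡ inY i
      filled-free i free = trans (filled-lookup i) (cong (λ b → if b then false else inY i) (dec-false (fixes? ρ i) free))

      filled-W : ∀ p → lookup filled (W p) ≡ false
      filled-W p = cases (fixes? ρ (W p))
        where
        cases : Dec (Fixes ρ (W p)) → lookup filled (W p) ≡ false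
        cases (yes fix) = trans (sym (filled-fixed (W p) fix)) (z-false (W p))
        cases (no free) = trans (filled-free (W p) free) (inY-W p)

      column-from : ∀ {r} → Dec (∃[ c ] ¬ Fixes ρ (Y r c)) → Fin n
      column-from (yes (c , _)) = c
      column-from (no _)        = origin

      free-column : Fin n → Fin n
      free-column r = column-from (free? r)

      filled-column : ∀ r → lookup R r ≡ true → lookup filled (Y r (free-column r)) ≡ true
      filled-column r on = cases (free? r) (trans (sym (R-lookup r)) on)
        where
        cases : (d : Dec (∃[ c ] ¬ Fixes ρ (Y r c))) → does d ≡ true → lookup filled (Y r (column-from d)) ≡ true
        cases (yes (c , free)) _ = trans (filled-free (Y r c) free) (inY-Y r c)

      module _ (few : 2 * length (unflagged R) ≤ n) where

        some-flagged : ∃[ r ] lookup R r ≡ true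
        some-flagged with Fin.any? (λ r → lookup R r Bool.≟ true)
        ... | yes some = some
        ... | no  none = contradiction few (ℕ.<⇒≱ (subst (λ u → n ℕ.< 2 * u) (sym all-unflagged) (ℕ.m<m+n n (subst (0 ℕ.<_) (sym (ℕ.+-identityʳ n)) n>0))))
          where
          off : ∀ {b} → ¬ (b ≡ true) → b ≡ false
          off {false} _ = refl
          off {true}  h = contradiction refl h
          all-unflagged : length (unflagged R) ≡ n
          all-unflagged = trans (cong length (List.filter-all (λ r → lookup R r Bool.≟ false) {xs = allFin n}
              (All.tabulate (λ {r} _ → off (λ on → none (r , on))))))
            (List.length-tabulate {n = n} (λ i → i))

        S : List Node
        S = survivors R L (suc D) []

        -- The choice of the labelling `L` bounds the number of survivors by `n`, so they can be
        -- listed. The height is `suc D` because nodes have depths 0 to `D`.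
        filled-described : ∃[ y ] φ false filled y ≡ true
        filled-described = zero-exists R S (subst (_≤ n) (sym (length-survivors R L (suc D) [])) (few-survivors R few)) origin≡0
          short (top (hit R (label [])) refl) closed filled free-column (proj₁ some-flagged) (proj₂ some-flagged) filled-column filled-W
          where
          short : ∀ {q} → q List.∈ S → length q ≤ D
          short {q} q∈ = ℕ.s≤s⁻¹ (subst (length q ℕ.<_) (ℕ.+-identityʳ (suc D)) (length-survivor R L (suc D) [] q q∈))
          top : ∀ b → hit R (label []) ≡ b → hit R (label []) ≡ true ⊎ S ! 0 ≡ just []
          top true  h = inj₁ h
          top false h = inj₂ (cong (_! 0) (proj₂ (root-listed-first R L D [] h)))
          closed : ∀ {q} s → q List.∈ S → length q ℕ.< D → hit R (label (s ∷ q)) ≡ true ⊎ (s ∷ q) List.∈ S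
          closed {q} s q∈ q<D = cases (hit R (label (s ∷ q))) refl
            where
            cases : ∀ b → hit R (label (s ∷ q)) ≡ b → hit R (label (s ∷ q)) ≡ true ⊎ (s ∷ q) List.∈ S
            cases true  h = inj₁ h
            cases false h = inj₂ (child-survives R L (suc D) [] q s q∈
              (subst (suc (length q) ℕ.<_) (sym (ℕ.+-identityʳ (suc D))) (ℕ.s≤s q<D)) h)

    -- Either more than half of the rows are fixed entirely, which already costs n² / 2 cells, or
    -- `filled` is a completion with value 0, contrary to `ok`.
    not0-size : (∀ x → Consistent ρ x → Any (f x ≡_) (just true ∷ nothing ∷ [])) → n * n ≤ 2 * size ρ
    not0-size ok = cases (2 * length (unflagged R) ℕ.≤? n)
      where
      open ℕ.≤-Reasoning
      absurd : ∀ {v : Value} → Any (v ≡_) (just true ∷ nothing ∷ []) → v ≡ just false → n * n ≤ 2 * size ρ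
      absurd (here refl) ()
      absurd (there (here refl)) ()
      cases : Dec (2 * length (unflagged R) ≤ n) → n * n ≤ 2 * size ρ
      cases (no many) = begin
        n * n                              ≤⟨ ℕ.*-monoˡ-≤ n (ℕ.<⇒≤ (ℕ.≰⇒> many)) ⟩
        2 * length (unflagged R) * n       ≡⟨ ℕ.*-assoc 2 (length (unflagged R)) n ⟩
        2 * (length (unflagged R) * n)     ≤⟨ ℕ.*-monoʳ-≤ 2 fixed-rows ⟩
        2 * size ρ                         ∎
      cases (yes few) = absurd (ok filled (consistent-agree ρz filled-fixed))
        (f-described false filled (proj₁ (filled-described few)) (proj₂ (filled-described few)))

  C-not0-≥ : ∀ {m} → m ≤ N → 2 * m ≤ n * n → m ≤ C-not0 f z
  C-not0-≥ m≤N 2m≤n² = C-at-≥ _ f m≤N λ ρ (ρz , ok) → ℕ.*-cancelˡ-≤ 2 (ℕ.≤-trans 2m≤n² (not0-size ρ ρz ok))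

-- The two matrices as coordinates of the input

padded : ∀ d → Node → Vec Bool d
padded zero    p       = []
padded (suc d) []      = false ∷ padded d []
padded (suc d) (b ∷ p) = b ∷ padded d p

toList-padded : ∀ d p → length p ≡ d → toList (padded d p) ≡ p
toList-padded zero    []      _   = refl
toList-padded (suc d) (b ∷ p) len = cong (b ∷_) (toList-padded d p (ℕ.suc-injective len))

padded-toList : ∀ {d} (v : Vec Bool d) → padded d (toList v) ≡ v
padded-toList []      = refl
padded-toList (b ∷ v) = cong (b ∷_) (padded-toList v)

module Construction (k : ℕ) where

  n D w N : ℕ
  n = 2 ^ k
  N = 2 * n ^ 2
  D = k + k
  w = 1 + (k + (D * 2 + (k + (k + k))))

  n>0 : 0 ℕ.< n
  n>0 = ℕ.m^n>0 2 k

  entryCode : Code (Entry (2 ^ k)) (Valid D) w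
  entryCode = bitCode ⊗ finCode k ⊗ nodeCode D ⊗ finCode k ⊗ finCode k ⊗ finCode k

  leaves≡ : 2 ^ D ≡ n ^ 2
  leaves≡ = trans (cong (λ j → 2 ^ (k + j)) (sym (ℕ.+-identityʳ k)))
    (trans (cong (2 ^_) (ℕ.*-comm 2 k)) (sym (ℕ.^-*-assoc 2 k 2)))

  leafIndex : Node → Fin (n ^ 2)
  leafIndex p = Fin.cast leaves≡ (bits→fin (padded D p))

  -- The cells of `W` occupy the first `n ^ 2` coordinates, those of `Y` the others. The summand 0
  -- and the inner `zero` in `Y` reflect how `2 * n ^ 2` and `n ^ 2` unfold. Only nodes of depth `D`
  -- are indexed faithfully; other depths are cut or padded.
  W : Node → Fin (2 * (2 ^ k) ^ 2)
  W p = leafIndex p Fin.↑ˡ (n ^ 2 + 0)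

  Y : Fin (2 ^ k) → Fin (2 ^ k) → Fin (2 * (2 ^ k) ^ 2)
  Y r c = n ^ 2 Fin.↑ʳ (combine r (combine c zero) Fin.↑ˡ 0)

  inY : Fin (2 * (2 ^ k) ^ 2) → Bool
  inY i = [ (λ _ → false) , (λ _ → true) ]′ (Fin.splitAt (n ^ 2) i)

  inY-W : ∀ p → inY (W p) ≡ false
  inY-W p = cong [ (λ _ → false) , (λ _ → true) ]′ (Fin.splitAt-↑ˡ (n ^ 2) (leafIndex p) (n ^ 2 + 0))

  inY-Y : ∀ r c → inY (Y r c) ≡ true
  inY-Y r c = cong [ (λ _ → false) , (λ _ → true) ]′ (Fin.splitAt-↑ʳ (n ^ 2) (n ^ 2 + 0) (combine r (combine c zero) Fin.↑ˡ 0))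

  cast-injective : ∀ {a b} (eq : a ≡ b) {i j : Fin a} → Fin.cast eq i ≡ Fin.cast eq j → i ≡ j
  cast-injective refl {i} {j} h = trans (sym (Fin.cast-is-id refl i)) (trans h (Fin.cast-is-id refl j))

  W-injective : ∀ {p q} → length p ≡ D → length q ≡ D → W p ≡ W q → p ≡ q
  W-injective {p} {q} |p| |q| eq = trans (sym (toList-padded D p |p|)) (trans (cong toList
    (bits→fin-injective (padded D p) (padded D q) (cast-injective leaves≡
      (Fin.↑ˡ-injective (n ^ 2 + 0) (leafIndex p) (leafIndex q) eq))))
    (toList-padded D q |q|))

  Y-injective : ∀ {r c r′ c′} → Y r c ≡ Y r′ c′ → r ≡ r′ × c ≡ c′
  Y-injective {r} {c} {r′} {c′} eq = proj₁ outer , proj₁ (Fin.combine-injective c zero c′ zero (proj₂ outer))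
    where
    outer = Fin.combine-injective r (combine c zero) r′ (combine c′ zero)
      (Fin.↑ˡ-injective 0 _ _ (Fin.↑ʳ-injective (n ^ 2) _ _ eq))

  leaf-at : Fin (n ^ 2) → Node
  leaf-at i = toList (fin→bits D (Fin.cast (sym leaves≡) i))

  leafIndex-leaf-at : ∀ i → leafIndex (leaf-at i) ≡ i
  leafIndex-leaf-at i = trans (cong (Fin.cast leaves≡)
      (trans (cong bits→fin (padded-toList (fin→bits D (Fin.cast (sym leaves≡) i)))) (fin→bits→fin D (Fin.cast (sym leaves≡) i))))
    (trans (Fin.cast-trans (sym leaves≡) leaves≡ i) (Fin.cast-is-id refl i))

  W-leaf-at-injective : Injective _≡_ _≡_ (W ∘ leaf-at)
  W-leaf-at-injective {i} {j} eq = trans (sym (leafIndex-leaf-at i))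
    (trans (Fin.↑ˡ-injective (n ^ 2 + 0) _ _ eq) (leafIndex-leaf-at j))

  origin : Fin (2 ^ k)
  origin = Fin.fromℕ< n>0

  labelling : ∃[ L ] ∀ R → 2 * length (Labelling.unflagged n R) ≤ n → Labelling.survivors# n R L (suc D) ≤ n
  labelling = Labelling.labelling-exists n origin (suc D)

  open Bounds {2 ^ k} {D} {w} {2 * (2 ^ k) ^ 2} entryCode W Y inY W-injective Y-injective inY-W inY-Y origin (Fin.toℕ-fromℕ< n>0)
    (proj₁ labelling) (proj₂ labelling) public hiding (n>0)

  n²≡n*n : n ^ 2 ≡ n * n
  n²≡n*n = cong (n *_) (ℕ.*-identityʳ n)

  n²≤N : n ^ 2 ≤ N
  n²≤N = ℕ.m≤m+n (n ^ 2) (n ^ 2 + 0)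

  n≤N : n ≤ N
  n≤N = ℕ.≤-trans (subst (n ≤_) (sym n²≡n*n) (ℕ.m≤m*n n n {{ℕ.>-nonZero n>0}})) n²≤N

  -- All `n ^ 2` cells of `W` have to be fixed, so `n ^ 2` itself is a lower bound and the stated
  -- one follows.
  C-not1-bound : 2 ^ k * (2 ^ k ∸ 1) ≤ 2 * C-not1 f z
  C-not1-bound = begin
    n * (n ∸ 1)          ≤⟨ ℕ.*-monoʳ-≤ n (ℕ.m∸n≤m n 1) ⟩
    n * n                ≡⟨ n²≡n*n ⟨
    n ^ 2                ≤⟨ C-not1-≥ leaf-at (λ i → Vec.length-toList (fin→bits D (Fin.cast (sym leaves≡) i))) W-leaf-at-injective n²≤N ⟩
    C-not1 f z           ≤⟨ ℕ.m≤m+n (C-not1 f z) (C-not1 f z + 0) ⟩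
    2 * C-not1 f z       ∎
    where open ℕ.≤-Reasoning

-- Explicit constants

½*fromℕ≤ : ∀ a c → a ≤ 2 * c → (½ ℚ.+ 0ℚ) ℚ.* fromℕ a ℚ.≤ fromℕ c
½*fromℕ≤ a c a≤2c = ℚ.toℚᵘ-cancel-≤ (begin
  ℚ.toℚᵘ (½ ℚ.* fromℕ a)              ≃⟨ ℚ.toℚᵘ-homo-* ½ (fromℕ a) ⟩
  ℚᵘ.½ ℚᵘ.* ℚ.toℚᵘ (fromℕ a)         ≃⟨ ℚᵘ.*-congˡ {ℚᵘ.½} (ℚ.toℚᵘ-fromℚᵘ (ℚᵘ.mkℚᵘ (ℤ.+ a) 0)) ⟩
  ℚᵘ.½ ℚᵘ.* ℚᵘ.mkℚᵘ (ℤ.+ a) 0         ≤⟨ ℚᵘ.*≤* (subst₂ ℤ._≤_ (trans (ℤ.pos-* (1 * a) 1) (cong (ℤ._* ℤ.+ 1) (ℤ.pos-* 1 a))) (ℤ.pos-* c 2) (ℤ.+≤+ half)) ⟩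
  ℚᵘ.mkℚᵘ (ℤ.+ c) 0                   ≃⟨ ℚ.toℚᵘ-fromℚᵘ (ℚᵘ.mkℚᵘ (ℤ.+ c) 0) ⟨
  ℚ.toℚᵘ (fromℕ c)                    ∎)
  where
  open ℚᵘ.≤-Reasoning
  half : 1 * a * 1 ≤ c * 2
  half = ℕ.≤-trans (ℕ.≤-reflexive (trans (ℕ.*-identityʳ (1 * a)) (ℕ.*-identityˡ a))) (subst (a ≤_) (ℕ.*-comm 2 c) a≤2c)

-- With h = ⌈k/2⌉, the power `2 ^ h` is an integer substitute for √n: its square is n or 2n.
half-exponent : ∀ k → ∃[ h ] k ≤ h + h × h + h ≤ suc k
half-exponent 0 = 0 , ℕ.z≤n , ℕ.z≤n
half-exponent 1 = 1 , ℕ.s≤s ℕ.z≤n , ℕ.≤-refl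
half-exponent (suc (suc k)) with half-exponent k
... | h , k≤ , ≤k = suc h
  , ℕ.s≤s (subst (suc k ≤_) (sym (ℕ.+-suc h h)) (ℕ.s≤s k≤))
  , ℕ.s≤s (subst (_≤ suc (suc k)) (sym (ℕ.+-suc h h)) (ℕ.s≤s ≤k))

half-power : ∀ k → 1 ≤ k → 2 ^ k ≡ 2 * 2 ^ (k ∸ 1)
half-power (suc k) _ = refl

module Asymptotics (k : ℕ) (1≤k : 1 ≤ k) where

  open Construction k public

  open ℕ-Solver using () renaming (con to con′; _:*_ to _:*′_; _:+_ to _:+′_; _:=_ to _:=′_)

  1≤nk : 1 ≤ n * k
  1≤nk = ℕ.*-mono-≤ n>0 1≤k

  n≤nk : n ≤ n * k
  n≤nk = ℕ.m≤m*n n k {{ℕ.>-nonZero 1≤k}}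

  w≡ : w ≡ 1 + 8 * k
  w≡ = ℕ-Solver.solve 1 (λ k → con′ 1 :+′ (k :+′ ((k :+′ k) :*′ con′ 2 :+′ (k :+′ (k :+′ k)))) :=′ con′ 1 :+′ con′ 8 :*′ k) refl k

  w≤9k : w ≤ 9 * k
  w≤9k = subst (_≤ 9 * k) (sym w≡) (ℕ.+-monoˡ-≤ (8 * k) 1≤k)

  ℓ-lower : 2 ^ k * k ≤ 1 * (2 ^ k * w)
  ℓ-lower = subst (n * k ≤_) (sym (ℕ.*-identityˡ (n * w)))
    (ℕ.*-monoʳ-≤ n (subst (k ≤_) (sym w≡) (ℕ.m≤n⇒m≤1+n (ℕ.m≤n*m k 8))))

  ℓ-upper : 2 ^ k * w ≤ 9 * (2 ^ k * k)
  ℓ-upper = ℕ.≤-trans (ℕ.*-monoʳ-≤ n w≤9k) (ℕ.≤-reflexive (regroup n k))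
    where
    regroup : ∀ n k → n * (9 * k) ≡ 9 * (n * k)
    regroup = ℕ-Solver.solve 2 (λ n k → n :*′ (con′ 9 :*′ k) :=′ con′ 9 :*′ (n :*′ k)) refl

  checks-false≤ : 5 * n ≤ 13 * (n * k)
  checks-false≤ = ℕ.*-mono-≤ {5} {13} (ℕ.m≤m+n 5 8) n≤nk

  checks-true≤ : suc (suc D * 4 * n) ≤ 13 * (n * k)
  checks-true≤ = begin
    suc (suc D * 4 * n)                  ≡⟨ expand n k ⟩
    1 + (4 * n + 8 * (n * k))            ≤⟨ ℕ.+-mono-≤ 1≤nk (ℕ.+-monoˡ-≤ (8 * (n * k)) (ℕ.*-monoʳ-≤ 4 n≤nk)) ⟩
    n * k + (4 * (n * k) + 8 * (n * k))  ≡⟨ collect (n * k) ⟩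
    13 * (n * k)                         ∎
    where
    open ℕ.≤-Reasoning
    expand : ∀ n k → suc (suc (k + k) * 4 * n) ≡ 1 + (4 * n + 8 * (n * k))
    expand = ℕ-Solver.solve 2 (λ n k → con′ 1 :+′ (con′ 1 :+′ (k :+′ k)) :*′ con′ 4 :*′ n
      :=′ con′ 1 :+′ (con′ 4 :*′ n :+′ con′ 8 :*′ (n :*′ k))) refl
    collect : ∀ m → m + (4 * m + 8 * m) ≡ 13 * m
    collect = ℕ-Solver.solve 1 (λ m → m :+′ (con′ 4 :*′ m :+′ con′ 8 :*′ m) :=′ con′ 13 :*′ m) refl

  length-checks≤ : ∀ b → length (checks b) ≤ 13 * (n * k)
  length-checks≤ false = ℕ.≤-trans (ℕ.≤-reflexive length-checks-false) checks-false≤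
  length-checks≤ true  = ℕ.≤-trans (ℕ.≤-reflexive length-checks-true) checks-true≤

  persists : ∀ b y → Σ[ I ∈ Subset (2 * (2 ^ k) ^ 2) ] ∣ I ∣ ≤ 13 * (2 ^ k * k)
    × (∀ x x′ → (∀ i → i ∈ I → lookup x i ≡ lookup x′ i) → φ b x y ≡ true → φ b x′ y ≡ true)
  persists b y = proj₁ I , ℕ.≤-trans (proj₁ (proj₂ I)) (length-checks≤ b) , proj₂ (proj₂ I)
    where I = persistent (checks b) y

  -- The summand `0ℚ` is the value of the o(1) term: the bound n² / 2 holds without error. As `n` is
  -- even for k ≥ 1, the half of n² is the integer `2 ^ (k ∸ 1) * n`.
  C-not0-bound : (½ ℚ.+ 0ℚ) ℚ.* fromℕ ((2 ^ k) ^ 2) ℚ.≤ fromℕ (C-not0 f z)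
  C-not0-bound = ½*fromℕ≤ (n ^ 2) (C-not0 f z) (begin
    n ^ 2                          ≡⟨ trans n²≡n*n halve ⟩
    2 * (2 ^ (k ∸ 1) * n)                ≤⟨ ℕ.*-monoʳ-≤ 2 (C-not0-≥ half≤N (ℕ.≤-reflexive (sym halve))) ⟩
    2 * C-not0 f z                 ∎)
    where
    open ℕ.≤-Reasoning
    halve : n * n ≡ 2 * (2 ^ (k ∸ 1) * n)
    halve = trans (cong (_* n) (half-power k 1≤k)) (ℕ.*-assoc 2 (2 ^ (k ∸ 1)) n)
    half≤N : 2 ^ (k ∸ 1) * n ≤ N
    half≤N = ℕ.≤-trans (ℕ.≤-trans (ℕ.m≤m+n (2 ^ (k ∸ 1) * n) _) (ℕ.≤-reflexive (trans (sym halve) (sym n²≡n*n)))) n²≤N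

  h : ℕ
  h = proj₁ (half-exponent k)

  -- Its square must reach 2 · 13 n k = 26 n k, and 6² ≥ 26. The factor `k` in place of √k keeps the
  -- order an integer and costs only a logarithmic factor.
  chebyshev-order : ℕ
  chebyshev-order = 6 * k * 2 ^ h

  n≤H² : n ≤ 2 ^ h * 2 ^ h
  n≤H² = subst (n ≤_) (ℕ.^-distribˡ-+-* 2 h h) (ℕ.^-monoʳ-≤ 2 (proj₁ (proj₂ (half-exponent k))))

  H²≤2n : 2 ^ h * 2 ^ h ≤ 2 * n
  H²≤2n = subst (_≤ 2 * n) (ℕ.^-distribˡ-+-* 2 h h) (ℕ.^-monoʳ-≤ 2 (proj₂ (proj₂ (half-exponent k))))

  chebyshev-order-large : 2 * (13 * (n * k)) ≤ chebyshev-order * chebyshev-order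
  chebyshev-order-large = begin
    2 * (13 * (n * k))                   ≡⟨ regroup n k ⟩
    26 * k * n                           ≤⟨ ℕ.*-mono-≤ (ℕ.*-mono-≤ {26} {36} (ℕ.m≤m+n 26 10) (ℕ.m≤m*n k k {{ℕ.>-nonZero 1≤k}})) n≤H² ⟩
    36 * (k * k) * (2 ^ h * 2 ^ h)       ≡⟨ square k (2 ^ h) ⟩
    chebyshev-order * chebyshev-order                        ∎
    where
    open ℕ.≤-Reasoning
    regroup : ∀ n k → 2 * (13 * (n * k)) ≡ 26 * k * n
    regroup = ℕ-Solver.solve 2 (λ n k → con′ 2 :*′ (con′ 13 :*′ (n :*′ k)) :=′ con′ 26 :*′ k :*′ n) refl
    square : ∀ k H → 36 * (k * k) * (H * H) ≡ (6 * k * H) * (6 * k * H)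
    square = ℕ-Solver.solve 2 (λ k H → con′ 36 :*′ (k :*′ k) :*′ (H :*′ H) :=′ (con′ 6 :*′ k :*′ H) :*′ (con′ 6 :*′ k :*′ H)) refl

  degree-bound : (d : ℕ) → d ≤ w + (4 * w + (w + 0)) →
    (chebyshev-order * (suc d + suc d)) ^ 2 ≤ (1320 * k ^ 2) ^ 2 * n
  degree-bound d d≤ = begin
    (chebyshev-order * (suc d + suc d)) ^ 2              ≤⟨ ℕ.^-monoˡ-≤ 2 (ℕ.*-monoʳ-≤ chebyshev-order (ℕ.+-mono-≤ d<55k d<55k)) ⟩
    (chebyshev-order * (55 * k + 55 * k)) ^ 2            ≡⟨ square 6 55 k (2 ^ h) ⟩
    -- Here 660 = 6 · (55 + 55). The bound 2n is relaxed to 4n in order to have a square factor,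
    -- which doubles 660 to 1320.
    (660 * (k * k)) * (660 * (k * k)) * (2 ^ h * 2 ^ h) ≤⟨ ℕ.*-monoʳ-≤ ((660 * (k * k)) * (660 * (k * k))) (ℕ.≤-trans H²≤2n (ℕ.*-monoˡ-≤ n (ℕ.m≤m+n 2 2))) ⟩
    (660 * (k * k)) * (660 * (k * k)) * (4 * n) ≡⟨ regroup 660 k n ⟩
    (1320 * k ^ 2) ^ 2 * n                     ∎
    where
    open ℕ.≤-Reasoning
    d<55k : suc d ≤ 55 * k
    d<55k = ℕ.≤-trans (ℕ.s≤s d≤) (ℕ.≤-trans (ℕ.≤-reflexive (cong suc (sixfold w)))
      (ℕ.≤-trans (ℕ.+-mono-≤ 1≤k (ℕ.*-monoʳ-≤ 6 w≤9k)) (ℕ.≤-reflexive (sum k))))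
      where
      sixfold : ∀ w → w + (4 * w + (w + 0)) ≡ 6 * w
      sixfold = ℕ-Solver.solve 1 (λ w → w :+′ (con′ 4 :*′ w :+′ (w :+′ con′ 0)) :=′ con′ 6 :*′ w) refl
      sum : ∀ k → k + 6 * (9 * k) ≡ 55 * k
      sum = ℕ-Solver.solve 1 (λ k → k :+′ con′ 6 :*′ (con′ 9 :*′ k) :=′ con′ 55 :*′ k) refl
    square : ∀ a b k H → (a * k * H * (b * k + b * k)) ^ 2 ≡ (a * (2 * b) * (k * k)) * (a * (2 * b) * (k * k)) * (H * H)
    square = ℕ-Solver.solve 4 (λ a b k H → (a :*′ k :*′ H :*′ (b :*′ k :+′ b :*′ k)) ℕ-Solver.:^ 2
      :=′ (a :*′ (con′ 2 :*′ b) :*′ (k :*′ k)) :*′ (a :*′ (con′ 2 :*′ b) :*′ (k :*′ k)) :*′ (H :*′ H)) refl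
    regroup : ∀ c k n → (c * (k * k)) * (c * (k * k)) * (4 * n) ≡ (2 * c * k ^ 2) ^ 2 * n
    regroup = ℕ-Solver.solve 3 (λ c k n → (c :*′ (k :*′ k)) :*′ (c :*′ (k :*′ k)) :*′ (con′ 4 :*′ n)
      :=′ (con′ 2 :*′ c :*′ k ℕ-Solver.:^ 2) ℕ-Solver.:^ 2 :*′ n) refl

  approximate-degree : ∀ b → ∃[ d ] ApproxDegree≤ (onConcatenation (φ b)) d × d ^ 2 ≤ (1320 * k ^ 2) ^ 2 * 2 ^ k
  approximate-degree b = chebyshev-order * (suc depth + suc depth)
    , accepts-degree (checks b) (checks-depth b) (13 * (n * k)) chebyshev-order {{ℕ.>-nonZero (ℕ.≤-trans 1≤nk (ℕ.m≤n*m (n * k) 13))}}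
        (length-checks≤ b) chebyshev-order-large
    , degree-bound depth ℕ.≤-refl

vanishing-0 : Vanishing (λ _ → 0ℚ)
vanishing-0 δ 0<δ = 0 , λ _ _ → ℚ.<⇒≤ 0<δ

-- Here `k` is log n. The inequality between squares at the end expresses d ≤ cd (log n)^e √n
-- without a square root, and the bound on `C-not1` is doubled to avoid the division by 2.
theorem3p1 :
  ∃[ cC ] ∃[ cℓ ] ∃[ cℓ′ ] ∃[ cI ] ∃[ cd ] ∃[ e ] Σ[ ε ∈ (ℕ → ℚ) ] Vanishing ε × (∃[ k₀ ] ∀ k → k₀ ≤ k →
    let n = 2 ^ k
        N = 2 * n ^ 2
    in
    Σ[ f ∈ PartialFunction N ] Σ[ z ∈ Input N ] Σ[ ℓ ∈ ℕ ] Σ[ φ ∈ (Bool → Input N → Vec Bool ℓ → Bool) ]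
      (f z ≡ nothing)
    × (n * k ≤ cℓ * ℓ × ℓ ≤ cℓ′ * (n * k))
    × (n ≤ C f × C f ≤ cC * (n * k))
    × (n * (n ∸ 1) ≤ 2 * C-not1 f z)
    × ((½ ℚ.+ ε k) ℚ.* fromℕ (n ^ 2) ℚ.≤ fromℕ (C-not0 f z))
    × (∀ b x → f x ≡ just b ⇔ (∃[ y ] φ b x y ≡ true))
    × (∀ b y → Σ[ I ∈ Subset N ]
          ∣ I ∣ ≤ cI * (n * k)
        × (∀ x x′ → (∀ i → i ∈ I → lookup x i ≡ lookup x′ i) → φ b x y ≡ true → φ b x′ y ≡ true))
    × (∀ b → ∃[ d ] ApproxDegree≤ (onConcatenation (φ b)) d × d ^ 2 ≤ (cd * k ^ e) ^ 2 * n))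
-- Both occurrences of 13 come from the number of checks, at most 13 n k. The constants 1 and 9 come
-- from k ≤ w ≤ 9k, and 1320 and 2 from `degree-bound`. The threshold k ≥ 1 lets `k` absorb additive
-- constants.
theorem3p1 = 13 , 1 , 9 , 13 , 1320 , 2 , (λ _ → 0ℚ) , vanishing-0 , 1 , λ k 1≤k → let open Asymptotics k 1≤k in
    f , z , 2 ^ k * w , φ
  , f-z
  , (ℓ-lower , ℓ-upper)
  , (C-≥ n≤N , C-≤ persists)
  , C-not1-bound
  , C-not0-bound
  , (λ b x → mk⇔ (f-just b x) (λ (y , eq) → f-described b x y eq))
  , persists
  , approximate-degree
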